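{- Let $m,n,o\ge 1$ and let $L_{m,n,o}$ be the generalized Laplacian matrix of the complete tripartite graph $K_{m,n,o}$, i.e. $L_{m,n,o}=\begin{pmatrix} \mathrm{diag}(x_1,\dots,x_m) & -J_{m,n} & -J_{m,o}\\ -J_{n,m} & \mathrm{diag}(y_1,\dots,y_n) & -J_{n,o}\\ -J_{o,m} & -J_{o,n} & \mathrm{diag}(z_1,\dots,z_o)\end{pmatrix}$, where $J_{p,q}$ is the all-ones $p\times q$ matrix. Then the $3$-minors of $L_{m,n,o}$, each taken with the sign making its leading coefficient positive, are the following polynomials, where $1\le i_1<i_2<i_3\le m$, $1\le j_1<j_2<j_3\le n$, $1\le k_1<k_2<k_3\le o$, and $i,j,k$ range over $[m],[n],[o]$: - $x_{i_1}$, $x_{i_1}x_{i_2}$, $x_{i_1}x_{i_2}x_{i_3}$ when $m\ge 3$; - $y_{j_1}$, $y_{j_1}y_{j_2}$, $y_{j_1}y_{j_2}y_{j_3}$ when $n\ge 3$; - $z_{k_1}$, $z_{k_1}z_{k_2}$, $z_{k_1}z_{k_2}z_{k_3}$ when $o\ge 3$; - $2$ when $m\ge2$, $n\ge 2$ and $o\ge 2$; - $-2-x_i-y_j-z_k+x_iy_jz_k$; - $x_{i_1}$, $y_{j_1}$, $x_{i_1}+2$, $y_{j_1}+2$, $x_{i_1}+x_{i_2}$, $y_{j_1}+y_{j_2}$, $x_{i_1}y_{j_1}$ when $m\ge 2$ and $n\ge 2$; - $x_{i_1}$, $z_{k_1}$, $x_{i_1}+2$, $z_{k_1}+2$, $x_{i_1}+x_{i_2}$,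 $z_{k_1}+z_{k_2}$, $x_{i_1}z_{k_1}$ when $m\ge 2$ and $o\ge 2$; - $y_{j_1}$, $z_{k_1}$, $y_{j_1}+2$, $z_{k_1}+2$, $y_{j_1}+y_{j_2}$, $z_{k_1}+z_{k_2}$, $y_{j_1}z_{k_1}$ when $n\ge 2$ and $o\ge 2$; - $y_{j_1}+z_{k_1}+2$, $x_{i_1}(y_{j_1}+1)$, $x_{i_1}(z_{k_1}+1)$, $x_{i_1}x_{i_2}+x_{i_1}+x_{i_2}$, $x_{i_1}x_{i_2}y_{j_1}-x_{i_1}-x_{i_2}$, $x_{i_1}x_{i_2}z_{k_1}-x_{i_1}-x_{i_2}$ when $m\ge 2$; - $x_{i_1}+z_{k_1}+2$, $y_{j_1}(x_{i_1}+1)$, $y_{j_1}(z_{k_1}+1)$, $y_{j_1}y_{j_2}+y_{j_1}+y_{j_2}$, $y_{j_1}y_{j_2}x_{i_1}-y_{j_1}-y_{j_2}$, $y_{j_1}y_{j_2}z_{k_1}-y_{j_1}-y_{j_2}$ when $n\ge 2$; - $x_{i_1}+y_{j_1}+2$, $z_{k_1}(x_{i_1}+1)$, $z_{k_1}(y_{j_1}+1)$, $z_{k_1}z_{k_2}+z_{k_1}+z_{k_2}$, $z_{k_1}z_{k_2}x_{i_1}-z_{k_1}-z_{k_2}$, $z_{k_1}z_{k_2}y_{j_1}-z_{k_1}-z_{k_2}$ when $o\ge 2$.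
   Context: A $3$-minor of a matrix is the determinant of a $3\times 3$ submatrix (choice of 3 rows and 3 columns). Here $x_1,\dots,x_m,y_1,\dots,y_n,z_1,\dots,z_o$ are indeterminates and the minors lie in the polynomial ring over $\mathbb{Z}$ in these indeterminates.
   Formalization: In the bullets for two parts of size ≥ 2, the two "+2" items are replaced by (variable of the third part)+2, e.g. z_k+2 when m,n≥2, since the printed list is false: K_{2,2,1} has the minor z_1+2, which is unlisted, while x_i+2 and y_j+2 are not minors. -}

module Defs where

open import Data.Bool.Base using (if_then_else_)
open import Data.Fin.Base using (Fin; zero; suc; _<_; _↑ˡ_; _↑ʳ_)
import Data.Fin.Properties as Fin
open import Data.Integer.Base as ℤ using (ℤ; +_; 0ℤ; 1ℤ)
open import Data.List.Base using (List; []; _∷_; map; cartesianProductWith)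
import Data.List.Base as List
open import Data.Nat.Base as ℕ using (ℕ; zero; suc)
import Data.Nat.Properties as ℕ
open import Data.Product.Base using (Σ-syntax; ∃-syntax; _×_; _,_)
open import Data.Sum.Base using (_⊎_)
open import Data.Vec.Base as Vec using (Vec)
open import Data.Vec.Functional using (Vector; removeAt; _++_)
open import Data.Vec.Properties using (≡-dec)
open import Level using (0ℓ)
open import Relation.Binary.Core using (Rel)
open import Relation.Binary.Structures using (IsTotalOrder)
open import Relation.Binary.PropositionalEquality using (_≡_; _≢_)
open import Relation.Nullary.Decidable using (does)

private
  variable
    N p q r : ℕ

infix  4 _≈_
infixl 6 _⊞_
infixl 7 _·_ _⊠_
infix  8 ⊟_

-- Polynomials over ℤ in N indeterminates.  A monomial is its exponent vector.

Monomial : ℕ → Set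
Monomial N = Vec ℕ N

unit : Monomial N
unit = Vec.replicate _ 0

_·_ : Monomial N → Monomial N → Monomial N
_·_ = Vec.zipWith ℕ._+_

-- A polynomial is a formal sum of terms in which monomials may repeat and
-- coefficients may vanish; equality is therefore equality of all coefficients.

Poly : ℕ → Set
Poly N = List (ℤ × Monomial N)

coeff : Poly N → Monomial N → ℤ
coeff []            μ = 0ℤ
coeff ((c , ν) ∷ f) μ = (if does (≡-dec ℕ._≟_ ν μ) then c else 0ℤ) ℤ.+ coeff f μ

_≈_ : Rel (Poly N) 0ℓ
f ≈ g = ∀ μ → coeff f μ ≡ coeff g μ

const : ℤ → Poly N
const c = (c , unit) ∷ []

var : Fin N → Poly N
var i = (1ℤ , Vec.updateAt unit i suc) ∷ []

_⊞_ : Poly N → Poly N → Poly N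
_⊞_ = List._++_

⊟_ : Poly N → Poly N
⊟_ = map λ (c , μ) → ℤ.- c , μ

_⊠_ : Poly N → Poly N → Poly N
_⊠_ = cartesianProductWith λ (c , μ) (d , ν) → c ℤ.* d , μ · ν

record MonomialOrder (N : ℕ) : Set₁ where
  field
    _≼_          : Rel (Monomial N) 0ℓ
    isTotalOrder : IsTotalOrder _≡_ _≼_
    unit-min     : ∀ μ → unit ≼ μ
    ·-monoˡ      : ∀ {μ ν} ρ → μ ≼ ν → (μ · ρ) ≼ (ν · ρ)

IsLeadingCoeff : MonomialOrder N → Poly N → ℤ → Set
IsLeadingCoeff ord f c =
  c ≢ 0ℤ × (∃[ μ ] coeff f μ ≡ c × (∀ ν → coeff f ν ≢ 0ℤ → ν ≼ μ))
  where open MonomialOrder ord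

-- The zero polynomial has no leading coefficient, so it does not qualify.
HasPositiveLeadingCoeff : MonomialOrder N → Poly N → Set
HasPositiveLeadingCoeff ord f = ∃[ c ] IsLeadingCoeff ord f c × 0ℤ ℤ.< c

Matrix : ℕ → ℕ → ℕ → Set
Matrix N p q = Vector (Vector (Poly N) q) p

alternatingSum : Vector (Poly N) p → Poly N
alternatingSum {p = zero}  f = const 0ℤ
alternatingSum {p = suc _} f = f zero ⊞ ⊟ alternatingSum λ i → f (suc i)

-- Laplace expansion along the first row.
det : Matrix N p p → Poly N
det {p = zero}  A = const 1ℤ
det {p = suc _} A =
  alternatingSum λ j → A zero j ⊠ det λ i → removeAt (A (suc i)) j

StrictlyIncreasing : Vector (Fin p) q → Set
StrictlyIncreasing s = ∀ {a b} → a < b → s a < s b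

IsMinor : (k : ℕ) → Matrix N p q → Poly N → Set
IsMinor {p = p} {q = q} k A f =
  Σ[ rows ∈ Vector (Fin p) k ] Σ[ cols ∈ Vector (Fin q) k ]
    StrictlyIncreasing rows × StrictlyIncreasing cols ×
    f ≈ det λ a b → A (rows a) (cols b)

IsSignNormalizedMinor : MonomialOrder N → (k : ℕ) → Matrix N p q → Poly N → Set
IsSignNormalizedMinor ord k A f =
  (IsMinor k A f ⊎ IsMinor k A (⊟ f)) × HasPositiveLeadingCoeff ord f

infixr 6 _∣_

_∣_ : Matrix N p q → Matrix N p r → Matrix N p (q ℕ.+ r)
(A ∣ B) i = A i ++ B i

diag : Vector (Poly N) p → Matrix N p p
diag v i j = if does (i Fin.≟ j) then v i else const 0ℤ

-- The matrix written -J: every entry is -1.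
-J : (p q : ℕ) → Matrix N p q
-J p q i j = const ℤ.-1ℤ

module _ (m n o : ℕ) where

  size : ℕ
  size = m ℕ.+ (n ℕ.+ o)

  xs : Vector (Poly size) m
  xs i = var (i ↑ˡ (n ℕ.+ o))

  ys : Vector (Poly size) n
  ys j = var (m ↑ʳ (j ↑ˡ o))

  zs : Vector (Poly size) o
  zs k = var (m ↑ʳ (n ↑ʳ k))

  L : Matrix size size size
  L =  (diag xs ∣ -J m n  ∣ -J m o )
    ++ (-J n m  ∣ diag ys ∣ -J n o )
    ++ (-J o m  ∣ -J o n  ∣ diag zs)

-- The lists below are symmetric under permuting the three parts, so the items
-- that depend on one or two distinguished parts are given once, for arbitrary
-- u, v, w standing for the variables of those parts.

data OneLarge₃ (u : Vector (Poly N) p) : Poly N → Set where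
  u₁     : ∀ i₁                               → OneLarge₃ u (u i₁)
  u₁u₂   : ∀ {i₁ i₂}    → i₁ < i₂             → OneLarge₃ u (u i₁ ⊠ u i₂)
  u₁u₂u₃ : ∀ {i₁ i₂ i₃} → i₁ < i₂ → i₂ < i₃   → OneLarge₃ u (u i₁ ⊠ u i₂ ⊠ u i₃)

-- u and v are the parts of size at least 2.  The polynomial w + 2 comes from
-- rows (u₁, v₁, w) and columns (u₂, v₂, w), so it involves the third part.
data TwoLarge (u : Vector (Poly N) p) (v : Vector (Poly N) q)
              (w : Vector (Poly N) r) : Poly N → Set where
  u₁    : ∀ i                   → TwoLarge u v w (u i)
  v₁    : ∀ j                   → TwoLarge u v w (v j)
  w₁+2  : ∀ k                   → TwoLarge u v w (w k ⊞ const (+ 2))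
  u₁+u₂ : ∀ {i₁ i₂} → i₁ < i₂   → TwoLarge u v w (u i₁ ⊞ u i₂)
  v₁+v₂ : ∀ {j₁ j₂} → j₁ < j₂   → TwoLarge u v w (v j₁ ⊞ v j₂)
  u₁v₁  : ∀ i j                 → TwoLarge u v w (u i ⊠ v j)

data OneLarge₂ (u : Vector (Poly N) p) (v : Vector (Poly N) q)
               (w : Vector (Poly N) r) : Poly N → Set where
  v+w+2       : ∀ j k → OneLarge₂ u v w (v j ⊞ w k ⊞ const (+ 2))
  u[v+1]      : ∀ i j → OneLarge₂ u v w (u i ⊠ (v j ⊞ const (+ 1)))
  u[w+1]      : ∀ i k → OneLarge₂ u v w (u i ⊠ (w k ⊞ const (+ 1)))
  u₁u₂+u₁+u₂  : ∀ {i₁ i₂} → i₁ < i₂ →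
                OneLarge₂ u v w (u i₁ ⊠ u i₂ ⊞ u i₁ ⊞ u i₂)
  u₁u₂v-u₁-u₂ : ∀ {i₁ i₂} → i₁ < i₂ → ∀ j →
                OneLarge₂ u v w (u i₁ ⊠ u i₂ ⊠ v j ⊞ ⊟ u i₁ ⊞ ⊟ u i₂)
  u₁u₂w-u₁-u₂ : ∀ {i₁ i₂} → i₁ < i₂ → ∀ k →
                OneLarge₂ u v w (u i₁ ⊠ u i₂ ⊠ w k ⊞ ⊟ u i₁ ⊞ ⊟ u i₂)

module _ (m n o : ℕ) where
  private
    x = xs m n o
    y = ys m n o
    z = zs m n o

  data Listed : Poly (size m n o) → Set where
    m≥3     : ∀ {f} → 3 ℕ.≤ m → OneLarge₃ x f → Listed f
    n≥3     : ∀ {f} → 3 ℕ.≤ n → OneLarge₃ y f → Listed f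
    o≥3     : ∀ {f} → 3 ℕ.≤ o → OneLarge₃ z f → Listed f
    two     : 2 ℕ.≤ m → 2 ℕ.≤ n → 2 ℕ.≤ o → Listed (const (+ 2))
    xyz     : ∀ i j k →
              Listed (const (ℤ.- (+ 2)) ⊞ ⊟ x i ⊞ ⊟ y j ⊞ ⊟ z k ⊞ x i ⊠ y j ⊠ z k)
    m,n≥2   : ∀ {f} → 2 ℕ.≤ m → 2 ℕ.≤ n → TwoLarge x y z f → Listed f
    m,o≥2   : ∀ {f} → 2 ℕ.≤ m → 2 ℕ.≤ o → TwoLarge x z y f → Listed f
    n,o≥2   : ∀ {f} → 2 ℕ.≤ n → 2 ℕ.≤ o → TwoLarge y z x f → Listed f
    m≥2     : ∀ {f} → 2 ℕ.≤ m → OneLarge₂ x y z f → Listed f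
    n≥2     : ∀ {f} → 2 ℕ.≤ n → OneLarge₂ y x z f → Listed f
    o≥2     : ∀ {f} → 2 ℕ.≤ o → OneLarge₂ z x y f → Listed f

{-# OPTIONS --safe #-}
module Submission where

open import Defs
open import Data.Nat.Base using (ℕ; _≤_)
open import Data.Product.Base using (_×_; ∃-syntax)
open import Function.Bundles using (_⇔_)

open import Data.Bool.Base using (Bool; true; false; if_then_else_; _∧_; _∨_; not)
open import Data.Bool.ListAction using (all; any)
open import Data.Bool.Properties using (T-≡)
open import Data.Fin.Base using (Fin; zero; suc; _<_; _↑ˡ_; _↑ʳ_; punchIn; punchOut; splitAt)
open import Data.Fin.Patterns
open import Data.Fin.Permutation as Perm using (Permutation′; _⟨$⟩ʳ_; _⟨$⟩ˡ_; insert; inverseʳ; inverseˡ)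
import Data.Fin.Properties as Fin
open import Data.Integer.Base as ℤ using (ℤ; 0ℤ; +_)
import Data.Integer.Properties as ℤ
open import Data.List.Base as List
  using (List; []; _∷_; map; null; upTo; allFin; cartesianProduct; cartesianProductWith)
import Data.List.Extrema as Extrema
open import Data.List.Membership.Propositional using (_∈_; find)
open import Data.List.Membership.Propositional.Properties
  using (∈-map⁺; ∈-++⁺ˡ; ∈-++⁺ʳ; ∈-allFin; ∈-upTo⁺; ∈-cartesianProduct⁺; ∈-cartesianProductWith⁺)
import Data.List.Properties as List
open import Data.List.Relation.Unary.All as All using (All; []; _∷_)
import Data.List.Relation.Unary.All.Properties as All
open import Data.List.Relation.Unary.Any as Any using (Any; here; there)
import Data.List.Relation.Unary.Any.Properties as Any
open import Data.Nat.Base as ℕ using (zero; suc; z≤n; s≤s; _⊔_)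
import Data.Nat.Properties as ℕ
open import Data.Product.Base as Product using (Σ-syntax; _,_; proj₁; proj₂)
open import Data.Sum.Base as Sum using (_⊎_; inj₁; inj₂)
open import Data.Unit.Base using (tt)
open import Data.Vec.Base as Vec using (_∷_; [])
open import Data.Vec.Functional using (Vector; removeAt; fromList; replicate; updateAt; _++_)
import Data.Vec.Properties as Vec
open import Function.Base using (_∘_; id)
open import Function.Bundles using (mk⇔; Equivalence)
open import Relation.Binary.Bundles using (TotalOrder)
open import Relation.Binary.PropositionalEquality
open import Relation.Binary.Structures using (IsTotalOrder)
open import Relation.Nullary using (Dec; yes; no; does; contradiction; ¬_; ¬?; _×-dec_; _⊎-dec_)
open import Relation.Nullary.Decidable using (toWitness)

private
  variable
    A B : Set
    N p q r p′ q′ : ℕ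
    ar P D D′ : Vector ℕ 3

-- The determinant of a submatrix only involves the at most six vertices that index
-- its rows and columns.  Compressing each part to these vertices turns a 3-minor of
-- L m n o into one of some L a b c with a + b + c ≤ 6, up to an increasing renaming
-- of the variables; so the minors fall into finitely many patterns, and evaluating
-- them all shows that each is zero or, up to sign, on the list.  Conversely a listed
-- polynomial is a renaming of one for parts of size at most 3, where it is found
-- among the minors by search.  The signs are then forced: all negative terms of a
-- listed polynomial properly divide a positive one, so its leading coefficient is
-- positive for every monomial order, and that of its negative is not.

infix  4 _⊑_
infixr 6 _⊕_
infixr 9 _⊙_
infix  4 _≈±_

-- Strictly increasing maps of finite sets as inductive data

-- Strictly increasing maps Fin p → Fin q.
data _⊑_ : ℕ → ℕ → Set where
  end  : 0 ⊑ 0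
  keep : p ⊑ q → suc p ⊑ suc q
  skip : p ⊑ q → p ⊑ suc q

⟦_⟧ : p ⊑ q → Fin p → Fin q
⟦ keep θ ⟧ zero    = zero
⟦ keep θ ⟧ (suc i) = suc (⟦ θ ⟧ i)
⟦ skip θ ⟧ i       = suc (⟦ θ ⟧ i)

⟦⟧-increasing : (θ : p ⊑ q) → StrictlyIncreasing ⟦ θ ⟧
⟦⟧-increasing (keep θ) {zero}  {suc b} _         = s≤s z≤n
⟦⟧-increasing (keep θ) {suc a} {suc b} (s≤s a<b) = s≤s (⟦⟧-increasing θ a<b)
⟦⟧-increasing (skip θ)                 a<b       = s≤s (⟦⟧-increasing θ a<b)

⟦⟧-injective : (θ : p ⊑ q) {a b : Fin p} → ⟦ θ ⟧ a ≡ ⟦ θ ⟧ b → a ≡ b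
⟦⟧-injective (keep θ) {zero}  {zero}  _  = refl
⟦⟧-injective (keep θ) {suc a} {suc b} eq = cong suc (⟦⟧-injective θ (Fin.suc-injective eq))
⟦⟧-injective (skip θ)                 eq = ⟦⟧-injective θ (Fin.suc-injective eq)

⊑⇒≤ : p ⊑ q → p ≤ q
⊑⇒≤ end      = z≤n
⊑⇒≤ (keep θ) = s≤s (⊑⇒≤ θ)
⊑⇒≤ (skip θ) = ℕ.m≤n⇒m≤1+n (⊑⇒≤ θ)

identity : ∀ p → p ⊑ p
identity zero    = end
identity (suc p) = keep (identity p)

⟦identity⟧ : ∀ p → ⟦ identity p ⟧ ≗ id
⟦identity⟧ (suc p) zero    = refl
⟦identity⟧ (suc p) (suc i) = cong suc (⟦identity⟧ p i)

_⊙_ : q ⊑ r → p ⊑ q → p ⊑ r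
end    ⊙ η      = η
keep θ ⊙ keep η = keep (θ ⊙ η)
keep θ ⊙ skip η = skip (θ ⊙ η)
skip θ ⊙ η      = skip (θ ⊙ η)

⟦⊙⟧ : (θ : q ⊑ r) (η : p ⊑ q) → ⟦ θ ⊙ η ⟧ ≗ ⟦ θ ⟧ ∘ ⟦ η ⟧
⟦⊙⟧ (keep θ) (keep η) zero    = refl
⟦⊙⟧ (keep θ) (keep η) (suc i) = cong suc (⟦⊙⟧ θ η i)
⟦⊙⟧ (keep θ) (skip η) i       = cong suc (⟦⊙⟧ θ η i)
⟦⊙⟧ (skip θ) η        i       = cong suc (⟦⊙⟧ θ η i)

thinnings : ∀ p q → List (p ⊑ q)
thinnings zero    zero    = end ∷ []
thinnings (suc p) zero    = []
thinnings zero    (suc q) = map skip (thinnings zero q)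
thinnings (suc p) (suc q) = map keep (thinnings p q) List.++ map skip (thinnings (suc p) q)

∈-thinnings : (θ : p ⊑ q) → θ ∈ thinnings p q
∈-thinnings             end      = here refl
∈-thinnings             (keep θ) = ∈-++⁺ˡ (∈-map⁺ keep (∈-thinnings θ))
∈-thinnings {p = zero}  (skip θ) = ∈-map⁺ skip (∈-thinnings θ)
∈-thinnings {p = suc p} (skip θ) = ∈-++⁺ʳ _ (∈-map⁺ skip (∈-thinnings θ))

lower : (s : Vector (Fin (suc q)) p) → (∀ i → s i ≢ zero) → StrictlyIncreasing s →
        Σ[ s′ ∈ Vector (Fin q) p ] StrictlyIncreasing s′ × (suc ∘ s′ ≗ s)
lower s s≢0 inc = s′ , inc′ , eq
  where
  s′ = λ i → punchOut (s≢0 i ∘ sym)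
  eq : suc ∘ s′ ≗ s
  eq i = Fin.punchIn-punchOut (s≢0 i ∘ sym)
  inc′ : StrictlyIncreasing s′
  inc′ {a} {b} a<b = ℕ.s<s⁻¹ (subst₂ _<_ (sym (eq a)) (sym (eq b)) (inc a<b))

-- By recursion on the codomain: only the first index can have the value `zero`, which decides
-- between `keep` and `skip`, and the remaining values avoid `zero` and so shift down. This turns
-- the row and column choices of a minor, given as functions, into data that can be enumerated and
-- matched on.
fromIncreasing : (s : Vector (Fin q) p) → StrictlyIncreasing s → Σ[ θ ∈ p ⊑ q ] ⟦ θ ⟧ ≗ s
fromIncreasing {zero}  {zero}  s inc = end , λ ()
fromIncreasing {zero}  {suc p} s inc with () ← s zero
fromIncreasing {suc q} {p}     s inc = go p s inc
  where
  skipped : ∀ {p} (s : Vector (Fin (suc q)) p) → (∀ i → s i ≢ zero) → StrictlyIncreasing s →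
            Σ[ θ ∈ p ⊑ suc q ] ⟦ θ ⟧ ≗ s
  skipped s s≢0 inc with s′ , inc′ , eq ← lower s s≢0 inc
                       with θ , θ≗s′ ← fromIncreasing s′ inc′ =
    skip θ , λ i → trans (cong suc (θ≗s′ i)) (eq i)

  above : ∀ {n} {i j : Fin (suc n)} → i < j → j ≢ zero
  above () refl

  go : ∀ p (s : Vector (Fin (suc q)) p) → StrictlyIncreasing s → Σ[ θ ∈ p ⊑ suc q ] ⟦ θ ⟧ ≗ s
  go zero    s inc = skipped s (λ ()) inc
  go (suc p) s inc with s zero in s0
  ... | suc _ = skipped s s≢0 inc
    where
    s≢0 : ∀ i → s i ≢ zero
    s≢0 zero    eq = contradiction (trans (sym s0) eq) λ ()
    s≢0 (suc i) = above (inc (s≤s z≤n))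
  ... | zero with s′ , inc′ , eq ← lower (s ∘ suc) (λ i → above (inc {zero} {suc i} (s≤s z≤n))) (inc ∘ s≤s)
             with θ , θ≗s′ ← fromIncreasing s′ inc′ = keep θ , λ where
    zero    → sym s0
    (suc i) → trans (cong suc (θ≗s′ i)) (eq i)

-- An element missed by `θ` is discarded as long as at least `K` others remain; from then on
-- everything is retained. The image of `θ` is thereby enlarged to exactly `K` elements.
extend : ∀ {K} (θ : p ⊑ q) → p ≤ K → K ≤ q →
         Σ[ θ₁ ∈ K ⊑ q ] Σ[ θ₂ ∈ p ⊑ K ] ⟦ θ₁ ⟧ ∘ ⟦ θ₂ ⟧ ≗ ⟦ θ ⟧
extend end z≤n z≤n = end , end , λ ()
extend (keep θ) (s≤s p≤K) (s≤s K≤q) with θ₁ , θ₂ , eq ← extend θ p≤K K≤q =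
  keep θ₁ , keep θ₂ , λ where
    zero    → refl
    (suc i) → cong suc (eq i)
extend {q = suc q} {K} (skip θ) p≤K K≤q with ℕ.m≤n⇒m<n∨m≡n K≤q
... | inj₂ refl = identity _ , skip θ , λ i → ⟦identity⟧ _ _
... | inj₁ (s≤s K≤q′) with θ₁ , θ₂ , eq ← extend θ p≤K K≤q′ =
  skip θ₁ , θ₂ , λ i → cong suc (eq i)

_⊕_ : p ⊑ q → p′ ⊑ q′ → p ℕ.+ p′ ⊑ q ℕ.+ q′
end    ⊕ η = η
keep θ ⊕ η = keep (θ ⊕ η)
skip θ ⊕ η = skip (θ ⊕ η)

⟦⊕⟧-↑ˡ : (θ : p ⊑ q) (η : p′ ⊑ q′) (i : Fin p) → ⟦ θ ⊕ η ⟧ (i ↑ˡ p′) ≡ ⟦ θ ⟧ i ↑ˡ q′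
⟦⊕⟧-↑ˡ (keep θ) η zero    = refl
⟦⊕⟧-↑ˡ (keep θ) η (suc i) = cong suc (⟦⊕⟧-↑ˡ θ η i)
⟦⊕⟧-↑ˡ (skip θ) η i       = cong suc (⟦⊕⟧-↑ˡ θ η i)

⟦⊕⟧-↑ʳ : (θ : p ⊑ q) (η : p′ ⊑ q′) (j : Fin p′) → ⟦ θ ⊕ η ⟧ (p ↑ʳ j) ≡ q ↑ʳ ⟦ η ⟧ j
⟦⊕⟧-↑ʳ end      η j = refl
⟦⊕⟧-↑ʳ (keep θ) η j = cong suc (⟦⊕⟧-↑ʳ θ η j)
⟦⊕⟧-↑ʳ (skip θ) η j = cong suc (⟦⊕⟧-↑ʳ θ η j)

-- Indexed by the thinning itself, so that matching on `_and_` also turns its domain size into a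
-- sum, and no transport between sizes arises.
data Split (q q′ : ℕ) : r ⊑ q ℕ.+ q′ → Set where
  _and_ : (θ : p ⊑ q) (η : p′ ⊑ q′) → Split q q′ (θ ⊕ η)

split : ∀ q (θ : r ⊑ q ℕ.+ q′) → Split q q′ θ
split zero    θ = end and θ
split (suc q) (keep θ) with θ₁ and θ₂ ← split q θ = keep θ₁ and θ₂
split (suc q) (skip θ) with θ₁ and θ₂ ← split q θ = skip θ₁ and θ₂

-- The union of the rows and columns of a minor

-- Pairs of thinnings p ⊑ r and q ⊑ r that are jointly surjective.
data Cover : ℕ → ℕ → ℕ → Set where
  done  : Cover 0 0 0
  left  : Cover p q r → Cover (suc p) q (suc r)
  right : Cover p q r → Cover p (suc q) (suc r)
  both  : Cover p q r → Cover (suc p) (suc q) (suc r)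

left⊑ : Cover p q r → p ⊑ r
left⊑ done      = end
left⊑ (left c)  = keep (left⊑ c)
left⊑ (right c) = skip (left⊑ c)
left⊑ (both c)  = keep (left⊑ c)

right⊑ : Cover p q r → q ⊑ r
right⊑ done      = end
right⊑ (left c)  = skip (right⊑ c)
right⊑ (right c) = keep (right⊑ c)
right⊑ (both c)  = keep (right⊑ c)

-- `ι` includes the union of the two images: an element is skipped exactly when both thinnings skip
-- it. The factorisations are equations between thinnings, so later proofs match them with `refl`.
cover : (θ : p ⊑ N) (η : q ⊑ N) → ∃[ r ] Σ[ c ∈ Cover p q r ] Σ[ ι ∈ r ⊑ N ]
        ι ⊙ left⊑ c ≡ θ × ι ⊙ right⊑ c ≡ η
cover end end = 0 , done , end , refl , refl
cover (keep θ) (keep η) with r , c , ι , refl , refl ← cover θ η = suc r , both c , keep ι , refl , refl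
cover (keep θ) (skip η) with r , c , ι , refl , refl ← cover θ η = suc r , left c , keep ι , refl , refl
cover (skip θ) (keep η) with r , c , ι , refl , refl ← cover θ η = suc r , right c , keep ι , refl , refl
cover (skip θ) (skip η) with r , c , ι , refl , refl ← cover θ η = r , c , skip ι , refl , refl

Cover⇒≤ : Cover p q r → r ≤ p ℕ.+ q
Cover⇒≤ done = z≤n
Cover⇒≤ (left c) = s≤s (Cover⇒≤ c)
Cover⇒≤ {p} {suc q} (right c) rewrite ℕ.+-suc p q = s≤s (Cover⇒≤ c)
Cover⇒≤ {suc p} {suc q} (both c) =
  s≤s (ℕ.≤-trans (Cover⇒≤ c) (ℕ.+-monoʳ-≤ p (ℕ.n≤1+n q)))

covers : ∀ p q r → List (Cover p q r)
covers zero    zero    zero    = done ∷ []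
covers zero    zero    (suc r) = []
covers zero    (suc q) zero    = []
covers zero    (suc q) (suc r) = map right (covers zero q r)
covers (suc p) q       zero    = []
covers (suc p) zero    (suc r) = map left (covers p zero r)
covers (suc p) (suc q) (suc r) =
  map left (covers p (suc q) r) List.++ map right (covers (suc p) q r) List.++ map both (covers p q r)

∈-covers : (c : Cover p q r) → c ∈ covers p q r
∈-covers done = here refl
∈-covers {suc p} {zero}  (left c)  = ∈-map⁺ left (∈-covers c)
∈-covers {suc p} {suc q} (left c)  = ∈-++⁺ˡ (∈-map⁺ left (∈-covers c))
∈-covers {zero}  {suc q} (right c) = ∈-map⁺ right (∈-covers c)
∈-covers {suc p} {suc q} {suc r} (right c) =
  ∈-++⁺ʳ (map left (covers p (suc q) r)) (∈-++⁺ˡ (∈-map⁺ right (∈-covers c)))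
∈-covers {suc p} {suc q} {suc r} (both c) =
  ∈-++⁺ʳ (map left (covers p (suc q) r))
    (∈-++⁺ʳ (map right (covers (suc p) q r)) (∈-map⁺ both (∈-covers c)))

-- Restriction to fewer vertices as renaming of variables

splitAt-⊕ : (θ : p ⊑ q) (η : p′ ⊑ q′) (k : Fin (p ℕ.+ p′)) →
            splitAt q (⟦ θ ⊕ η ⟧ k) ≡ Sum.map ⟦ θ ⟧ ⟦ η ⟧ (splitAt p k)
splitAt-⊕ end      η k    = refl
splitAt-⊕ (keep θ) η zero = refl
splitAt-⊕ {p = suc p} (keep θ) η (suc k) rewrite splitAt-⊕ θ η k with splitAt p k
... | inj₁ _ = refl
... | inj₂ _ = refl
splitAt-⊕ {p = p} (skip θ) η k rewrite splitAt-⊕ θ η k with splitAt p k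
... | inj₁ _ = refl
... | inj₂ _ = refl

-- The relation is arbitrary because a block matrix is a `_++_` of rows that are themselves built by
-- `_++_`: the lemma serves once for whole rows and once for the entries within a row.
++-⊕ : (_~_ : A → B → Set) (θ : p ⊑ q) (η : p′ ⊑ q′)
       {u : Vector A q} {v : Vector A q′} {u′ : Vector B p} {v′ : Vector B p′} →
       (∀ i → u (⟦ θ ⟧ i) ~ u′ i) → (∀ j → v (⟦ η ⟧ j) ~ v′ j) →
       ∀ k → (u ++ v) (⟦ θ ⊕ η ⟧ k) ~ (u′ ++ v′) k
++-⊕ {p = p} _~_ θ η hu hv k rewrite splitAt-⊕ θ η k with splitAt p k
... | inj₁ i = hu i
... | inj₂ j = hv j

insertZeros : p ⊑ q → Monomial p → Monomial q
insertZeros end      []      = []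
insertZeros (keep θ) (a ∷ μ) = a ∷ insertZeros θ μ
insertZeros (skip θ) μ       = 0 ∷ insertZeros θ μ

insertZeros-unit : (θ : p ⊑ q) → insertZeros θ unit ≡ unit
insertZeros-unit end      = refl
insertZeros-unit (keep θ) = cong (0 ∷_) (insertZeros-unit θ)
insertZeros-unit (skip θ) = cong (0 ∷_) (insertZeros-unit θ)

-- Stated for any operation fixing zero, to cover both the sum of exponents in a product and the
-- truncated difference in `_◁_`.
insertZeros-zipWith : ∀ {_∙_ : ℕ → ℕ → ℕ} → 0 ∙ 0 ≡ 0 → (θ : p ⊑ q) (μ ν : Monomial p) →
  insertZeros θ (Vec.zipWith _∙_ μ ν) ≡ Vec.zipWith _∙_ (insertZeros θ μ) (insertZeros θ ν)
insertZeros-zipWith 0∙0 end      []      []      = refl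
insertZeros-zipWith 0∙0 (keep θ) (a ∷ μ) (b ∷ ν) = cong (_ ∷_) (insertZeros-zipWith 0∙0 θ μ ν)
insertZeros-zipWith 0∙0 (skip θ) μ       ν       = cong₂ _∷_ (sym 0∙0) (insertZeros-zipWith 0∙0 θ μ ν)

insertZeros-suc : (θ : p ⊑ q) (i : Fin p) →
                  insertZeros θ (Vec.updateAt unit i suc) ≡ Vec.updateAt unit (⟦ θ ⟧ i) suc
insertZeros-suc (keep θ) zero    = cong (1 ∷_) (insertZeros-unit θ)
insertZeros-suc (keep θ) (suc i) = cong (0 ∷_) (insertZeros-suc θ i)
insertZeros-suc (skip θ) i       = cong (0 ∷_) (insertZeros-suc θ i)

insertZeros-injective : (θ : p ⊑ q) {μ ν : Monomial p} → insertZeros θ μ ≡ insertZeros θ ν → μ ≡ ν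
insertZeros-injective end      {[]}    {[]}    _  = refl
insertZeros-injective (keep θ) {a ∷ μ} {b ∷ ν} eq =
  cong₂ _∷_ (Vec.∷-injectiveˡ eq) (insertZeros-injective θ (Vec.∷-injectiveʳ eq))
insertZeros-injective (skip θ) eq = insertZeros-injective θ (Vec.∷-injectiveʳ eq)

mapMonomials : (Monomial p → Monomial q) → Poly p → Poly q
mapMonomials h = map λ (c , μ) → c , h μ

rename : p ⊑ q → Poly p → Poly q
rename θ = mapMonomials (insertZeros θ)

rename-const : (θ : p ⊑ q) (c : ℤ) → rename θ (const c) ≡ const c
rename-const θ c = cong (λ μ → (c , μ) ∷ []) (insertZeros-unit θ)

rename-var : (θ : p ⊑ q) (i : Fin p) → rename θ (var i) ≡ var (⟦ θ ⟧ i)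
rename-var θ i = cong (λ μ → (_ , μ) ∷ []) (insertZeros-suc θ i)

rename-⊞ : (θ : p ⊑ q) (f g : Poly p) → rename θ (f ⊞ g) ≡ rename θ f ⊞ rename θ g
rename-⊞ θ f g = List.map-++ _ f g

rename-⊟ : (θ : p ⊑ q) (f : Poly p) → rename θ (⊟ f) ≡ ⊟ rename θ f
rename-⊟ θ []      = refl
rename-⊟ θ (_ ∷ f) = cong (_ ∷_) (rename-⊟ θ f)

rename-⊠ : (θ : p ⊑ q) (f g : Poly p) → rename θ (f ⊠ g) ≡ rename θ f ⊠ rename θ g
rename-⊠ θ []            g = refl
rename-⊠ θ ((c , μ) ∷ f) g = trans (List.map-++ _ (map _ g) (f ⊠ g)) (cong₂ _⊞_ (row g) (rename-⊠ θ f g))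
  where
  row : ∀ g → rename θ (map (λ (d , ν) → c ℤ.* d , μ · ν) g) ≡
              map (λ (d , ν) → c ℤ.* d , insertZeros θ μ · ν) (rename θ g)
  row []            = refl
  row ((d , ν) ∷ g) = cong₂ _∷_ (cong (_ ,_) (insertZeros-zipWith refl θ μ ν)) (row g)

alternatingSum-cong : {f g : Vector (Poly N) r} → f ≗ g → alternatingSum f ≡ alternatingSum g
alternatingSum-cong {r = zero}  eq = refl
alternatingSum-cong {r = suc _} eq =
  cong₂ (λ f g → f ⊞ ⊟ g) (eq zero) (alternatingSum-cong (eq ∘ suc))

det-cong : {A B : Matrix N r r} → (∀ i j → A i j ≡ B i j) → det A ≡ det B
det-cong {r = zero}  eq = refl
det-cong {r = suc _} eq = alternatingSum-cong λ j →
  cong₂ _⊠_ (eq zero j) (det-cong λ i k → eq (suc i) (punchIn j k))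

alternatingSum-rename : (θ : p ⊑ q) (f : Vector (Poly p) r) →
                        alternatingSum (rename θ ∘ f) ≡ rename θ (alternatingSum f)
alternatingSum-rename {r = zero}  θ f = sym (rename-const θ 0ℤ)
alternatingSum-rename {r = suc _} θ f = begin
  rename θ (f zero) ⊞ ⊟ alternatingSum (rename θ ∘ f ∘ suc)
    ≡⟨ cong (λ g → rename θ (f zero) ⊞ ⊟ g) (alternatingSum-rename θ (f ∘ suc)) ⟩
  rename θ (f zero) ⊞ ⊟ rename θ (alternatingSum (f ∘ suc))
    ≡⟨ cong (rename θ (f zero) ⊞_) (rename-⊟ θ (alternatingSum (f ∘ suc))) ⟨
  rename θ (f zero) ⊞ rename θ (⊟ alternatingSum (f ∘ suc))
    ≡⟨ rename-⊞ θ (f zero) (⊟ alternatingSum (f ∘ suc)) ⟨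
  rename θ (alternatingSum f) ∎
  where open ≡-Reasoning

-- Renaming acts on each term separately and commutes with every operation of `Poly` as an equality
-- of lists, so the whole expansion is handled by `_≡_` without congruence properties of `_≈_`.
det-rename : (θ : p ⊑ q) (A : Matrix p r r) → det (λ i j → rename θ (A i j)) ≡ rename θ (det A)
det-rename {r = zero}  θ A = sym (rename-const θ _)
det-rename {r = suc _} θ A = trans
  (alternatingSum-cong λ j →
    trans (cong (rename θ (A zero j) ⊠_) (det-rename θ λ i → removeAt (A (suc i)) j))
          (sym (rename-⊠ θ (A zero j) _)))
  (alternatingSum-rename θ λ j → A zero j ⊠ det λ i → removeAt (A (suc i)) j)

-- Thinnings are injective, so off-diagonal positions stay off the diagonal.
diag-rename : (ι : p′ ⊑ q′) (θ : p ⊑ q) (u : Vector (Poly q′) q) (u′ : Vector (Poly p′) p) →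
              (∀ i → u (⟦ θ ⟧ i) ≡ rename ι (u′ i)) →
              ∀ i j → diag u (⟦ θ ⟧ i) (⟦ θ ⟧ j) ≡ rename ι (diag u′ i j)
diag-rename ι θ u u′ eq i j with i Fin.≟ j | ⟦ θ ⟧ i Fin.≟ ⟦ θ ⟧ j
... | yes refl | yes _    = eq i
... | yes refl | no  θi≢θi = contradiction refl θi≢θi
... | no  i≢j  | yes θi≡θj = contradiction (⟦⟧-injective θ θi≡θj) i≢j
... | no  _    | no  _    = sym (rename-const ι 0ℤ)

module _ {m n o m′ n′ o′ : ℕ} (θ : m′ ⊑ m) (η : n′ ⊑ n) (ζ : o′ ⊑ o) where
  private
    ι : size m′ n′ o′ ⊑ size m n o
    ι = θ ⊕ η ⊕ ζ

  xs-rename : ∀ i → xs m n o (⟦ θ ⟧ i) ≡ rename ι (xs m′ n′ o′ i)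
  xs-rename i = sym (trans (rename-var ι _) (cong var (⟦⊕⟧-↑ˡ θ (η ⊕ ζ) i)))

  ys-rename : ∀ j → ys m n o (⟦ η ⟧ j) ≡ rename ι (ys m′ n′ o′ j)
  ys-rename j = sym (trans (rename-var ι _) (cong var (trans (⟦⊕⟧-↑ʳ θ (η ⊕ ζ) _)
                  (cong (m ↑ʳ_) (⟦⊕⟧-↑ˡ η ζ j)))))

  zs-rename : ∀ k → zs m n o (⟦ ζ ⟧ k) ≡ rename ι (zs m′ n′ o′ k)
  zs-rename k = sym (trans (rename-var ι _) (cong var (trans (⟦⊕⟧-↑ʳ θ (η ⊕ ζ) _)
                  (cong (m ↑ʳ_) (⟦⊕⟧-↑ʳ η ζ k)))))

  -- Deleting vertices of a complete tripartite graph leaves a complete tripartite graph, possibly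
  -- with empty parts: each block restricts to a block of the same form, and only the diagonals
  -- involve variables.
  L-rename : ∀ i j → L m n o (⟦ ι ⟧ i) (⟦ ι ⟧ j) ≡ rename ι (L m′ n′ o′ i j)
  L-rename = ++-⊕ row θ (η ⊕ ζ)
    (λ i → ++-⊕ entry θ (η ⊕ ζ) (diag-rename ι θ (xs m n o) (xs m′ n′ o′) xs-rename i) (++-⊕ entry η ζ ones ones))
    (++-⊕ row η ζ
      (λ i → ++-⊕ entry θ (η ⊕ ζ) ones (++-⊕ entry η ζ (diag-rename ι η (ys m n o) (ys m′ n′ o′) ys-rename i) ones))
      (λ i → ++-⊕ entry θ (η ⊕ ζ) ones (++-⊕ entry η ζ ones (diag-rename ι ζ (zs m n o) (zs m′ n′ o′) zs-rename i))))
    where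
    entry : Poly (size m n o) → Poly (size m′ n′ o′) → Set
    entry f g = f ≡ rename ι g
    row : Vector (Poly (size m n o)) (size m n o) → Vector (Poly (size m′ n′ o′)) (size m′ n′ o′) → Set
    row u v = ∀ j → entry (u (⟦ ι ⟧ j)) (v j)
    ones : ∀ {k} (i : Fin k) → const ℤ.-1ℤ ≡ rename ι (const ℤ.-1ℤ)
    ones _ = sym (rename-const ι _)

-- Collecting like terms, and testing equality by evaluation

_≟ᵐ_ : (μ ν : Monomial N) → Dec (μ ≡ ν)
_≟ᵐ_ = Vec.≡-dec ℕ._≟_

termCoeff : ℤ × Monomial N → Monomial N → ℤ
termCoeff (c , ν) μ = if does (ν ≟ᵐ μ) then c else 0ℤ

coeff-⊞ : (f g : Poly N) → ∀ μ → coeff (f ⊞ g) μ ≡ coeff f μ ℤ.+ coeff g μ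
coeff-⊞ []      g μ = sym (ℤ.+-identityˡ _)
coeff-⊞ (t ∷ f) g μ = trans (cong (ℤ._+_ (termCoeff t μ)) (coeff-⊞ f g μ))
  (sym (ℤ.+-assoc (termCoeff t μ) (coeff f μ) (coeff g μ)))

coeff-⊟ : (f : Poly N) → ∀ μ → coeff (⊟ f) μ ≡ ℤ.- coeff f μ
coeff-⊟ []            μ = refl
coeff-⊟ ((c , ν) ∷ f) μ with does (ν ≟ᵐ μ)
... | true  = trans (cong (ℤ._+_ (ℤ.- c)) (coeff-⊟ f μ)) (sym (ℤ.neg-distrib-+ c (coeff f μ)))
... | false = trans (cong (ℤ._+_ 0ℤ) (coeff-⊟ f μ)) (sym (ℤ.neg-distrib-+ 0ℤ (coeff f μ)))

consTerm : ℤ × Monomial N → Poly N → Poly N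
consTerm (c , μ) f = if does (c ℤ.≟ 0ℤ) then f else (c , μ) ∷ f

addTerm : ℤ × Monomial N → Poly N → Poly N
addTerm t       []            = consTerm t []
addTerm (c , μ) ((d , ν) ∷ f) =
  if does (μ ≟ᵐ ν) then consTerm (c ℤ.+ d , ν) f else (d , ν) ∷ addTerm (c , μ) f

simplify : Poly N → Poly N
simplify = List.foldr addTerm []

module _ (h : Monomial p → Monomial q) where

  private
    _at_ : Poly p → Monomial q → ℤ
    f at μ = coeff (mapMonomials h f) μ

  coeff-consTerm : ∀ t f μ → consTerm t f at μ ≡ (t ∷ f) at μ
  coeff-consTerm (c , ν) f μ with c ℤ.≟ 0ℤ
  ... | no  _    = refl
  ... | yes refl with does (h ν ≟ᵐ μ)
  ...   | true  = sym (ℤ.+-identityˡ _)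
  ...   | false = sym (ℤ.+-identityˡ _)

  coeff-addTerm : ∀ t f μ → addTerm t f at μ ≡ (t ∷ f) at μ
  coeff-addTerm t       []            μ = coeff-consTerm t [] μ
  coeff-addTerm (c , ρ) ((d , ν) ∷ f) μ with ρ ≟ᵐ ν
  ... | yes refl = trans (coeff-consTerm (c ℤ.+ d , ν) f μ) collect
    where
    collect : ((c ℤ.+ d , ν) ∷ f) at μ ≡ ((c , ν) ∷ (d , ν) ∷ f) at μ
    collect with does (h ν ≟ᵐ μ)
    ... | true  = ℤ.+-assoc c d _
    ... | false = sym (ℤ.+-identityˡ _)
  ... | no _ = begin
    x ℤ.+ addTerm (c , ρ) f at μ   ≡⟨ cong (ℤ._+_ x) (coeff-addTerm (c , ρ) f μ) ⟩
    x ℤ.+ (y ℤ.+ f at μ)           ≡⟨ ℤ.+-assoc x y _ ⟨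
    (x ℤ.+ y) ℤ.+ f at μ           ≡⟨ cong (ℤ._+ f at μ) (ℤ.+-comm x y) ⟩
    (y ℤ.+ x) ℤ.+ f at μ           ≡⟨ ℤ.+-assoc y x _ ⟩
    y ℤ.+ (x ℤ.+ f at μ)           ∎
    where
    open ≡-Reasoning
    x = termCoeff (d , h ν) μ
    y = termCoeff (c , h ρ) μ

  -- Terms with equal monomials keep equal monomials under any `h`, so collecting them first changes
  -- no coefficient afterwards. This carries a computation in few variables over to arbitrarily
  -- many.
  coeff-simplify : ∀ f μ → simplify f at μ ≡ f at μ
  coeff-simplify []            μ = refl
  coeff-simplify (t@(c , ν) ∷ f) μ =
    trans (coeff-addTerm t (simplify f) μ) (cong (ℤ._+_ (termCoeff (c , h ν) μ)) (coeff-simplify f μ))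

isZero : Poly N → Bool
isZero = null ∘ simplify

null⇒≡[] : {xs : List A} → null xs ≡ true → xs ≡ []
null⇒≡[] {xs = []} _ = refl

isZero-sound : (h : Monomial p → Monomial q) (f : Poly p) → isZero f ≡ true → mapMonomials h f ≈ []
isZero-sound h f f≃0 μ = trans (sym (coeff-simplify h f μ))
  (cong (λ g → coeff (mapMonomials h g) μ) (null⇒≡[] f≃0))

⊞-⊟-zero : (f g : Poly N) → f ⊞ ⊟ g ≈ [] → f ≈ g
⊞-⊟-zero f g f-g≈0 μ = ℤ.i-j≡0⇒i≡j (coeff f μ) (coeff g μ)
  (trans (sym (trans (coeff-⊞ f (⊟ g) μ) (cong (ℤ._+_ (coeff f μ)) (coeff-⊟ g μ)))) (f-g≈0 μ))

-- `simplify` does not sort the monomials, so equality is tested by reducing the difference to the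
-- empty list instead of comparing two simplified forms.
agree : Poly N → Poly N → Bool
agree f g = isZero (f ⊞ ⊟ g)

agree-sound : (θ : p ⊑ q) (f g : Poly p) → agree f g ≡ true → rename θ f ≈ rename θ g
agree-sound θ f g t = ⊞-⊟-zero (rename θ f) (rename θ g)
  (subst (_≈ []) (trans (rename-⊞ θ f (⊟ g)) (cong (rename θ f ⊞_) (rename-⊟ θ g)))
    (isZero-sound (insertZeros θ) (f ⊞ ⊟ g) t))

-- Leading coefficients that are positive for every monomial order

_◁_ : Monomial N → Monomial N → Set
-- Proper divisibility. The truncated difference of exponents is the only possible cofactor, and it
-- restores `ν` exactly when `μ` divides `ν`; so the relation is decided without a search.
μ ◁ ν = μ · Vec.zipWith ℕ._∸_ ν μ ≡ ν × μ ≢ ν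

_◁?_ : (μ ν : Monomial N) → Dec (μ ◁ ν)
μ ◁? ν = (_ ≟ᵐ ν) ×-dec ¬? (μ ≟ᵐ ν)

-- Every negative term properly divides a positive one, so the largest monomial
-- has a positive coefficient whatever the monomial order.
Dominated : Poly N → Set
Dominated f = All (λ (c , μ) → 0ℤ ℤ.< c ⊎ Any (λ (d , ν) → 0ℤ ℤ.< d × μ ◁ ν) f) f

dominated? : (f : Poly N) → Dec (Dominated f)
dominated? f = All.all? (λ (c , μ) → (0ℤ ℤ.<? c) ⊎-dec Any.any? (λ (d , ν) → (0ℤ ℤ.<? d) ×-dec (μ ◁? ν)) f) f

◁-insertZeros : (θ : p ⊑ q) {μ ν : Monomial p} → μ ◁ ν → insertZeros θ μ ◁ insertZeros θ ν
◁-insertZeros θ {μ} {ν} (eq , μ≢ν) =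
  trans (cong (insertZeros θ μ ·_) (sym (insertZeros-zipWith refl θ ν μ)))
    (trans (sym (insertZeros-zipWith refl θ μ _)) (cong (insertZeros θ) eq)) ,
  μ≢ν ∘ insertZeros-injective θ

Dominated-rename : (θ : p ⊑ q) {f : Poly p} → Dominated f → Dominated (rename θ f)
Dominated-rename θ = All.map⁺ ∘ All.map
  (Sum.map₂ (Any.map⁺ ∘ Any.map λ (0<d , μ◁ν) → 0<d , ◁-insertZeros θ μ◁ν))

coeff-nonneg : (f : Poly N) {μ : Monomial N} →
               All (λ (c , ν) → ν ≡ μ → 0ℤ ℤ.< c) f → 0ℤ ℤ.≤ coeff f μ
coeff-nonneg []            []         = ℤ.≤-refl
coeff-nonneg ((c , ν) ∷ f) {μ} (pos ∷ ps) with ν ≟ᵐ μ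
... | yes ν≡μ = ℤ.+-mono-≤ (ℤ.<⇒≤ (pos ν≡μ)) (coeff-nonneg f ps)
... | no  _   = ℤ.+-mono-≤ (ℤ.≤-refl {0ℤ}) (coeff-nonneg f ps)

-- Several terms may share the monomial `μ`; as all of them are positive, they cannot cancel.
coeff-positive : (f : Poly N) {μ : Monomial N} → All (λ (c , ν) → ν ≡ μ → 0ℤ ℤ.< c) f →
                 μ ∈ map proj₂ f → 0ℤ ℤ.< coeff f μ
coeff-positive ((c , ν) ∷ f) {μ} (pos ∷ ps) μ∈f with ν ≟ᵐ μ | μ∈f
... | yes ν≡μ | _          = ℤ.+-mono-<-≤ (pos ν≡μ) (coeff-nonneg f ps)
... | no  ν≢μ | here μ≡ν   = contradiction (sym μ≡ν) ν≢μ
... | no  _   | there μ∈f′ = ℤ.+-mono-≤-< (ℤ.≤-refl {0ℤ}) (coeff-positive f ps μ∈f′)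

coeff≢0⇒∈ : (f : Poly N) {μ : Monomial N} → coeff f μ ≢ 0ℤ → μ ∈ map proj₂ f
coeff≢0⇒∈ []            ≢0 = contradiction refl ≢0
coeff≢0⇒∈ ((c , ν) ∷ f) {μ} ≢0 with ν ≟ᵐ μ
... | yes ν≡μ = here (sym ν≡μ)
... | no  _   = there (coeff≢0⇒∈ f (≢0 ∘ trans (ℤ.+-identityˡ _)))

module _ (ord : MonomialOrder N) where
  open MonomialOrder ord
  open IsTotalOrder isTotalOrder using (antisym)

  private
    totalOrder : TotalOrder _ _ _
    totalOrder = record { isTotalOrder = isTotalOrder }
    open Extrema totalOrder using (max; xs≤max; argmax-sel)

  -- Multiply `unit ≼ ρ` by `μ`: a divisor never exceeds its multiple.
  ≼-· : ∀ μ ρ → μ ≼ (μ · ρ)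
  ≼-· μ ρ = subst₂ _≼_ (Vec.zipWith-identityˡ ℕ.+-identityˡ μ) (Vec.zipWith-comm ℕ.+-comm ρ μ)
    (·-monoˡ μ (unit-min ρ))

  -- The largest monomial in the list properly divides no other monomial of the list, since it would
  -- be smaller. By domination every term carrying it is then positive, and so is its coefficient.
  Dominated⇒positive : ∀ {f} → Dominated f → f ≢ [] → HasPositiveLeadingCoeff ord f
  Dominated⇒positive {[]}    _   f≢[] = contradiction refl f≢[]
  Dominated⇒positive {f@((_ , μ₀) ∷ f′)} dom _    =
    coeff f μ , (ℤ.<⇒≢ 0<c ∘ sym , μ , refl , λ ν → All.lookup ≼max ∘ coeff≢0⇒∈ f) , 0<c
    where
    -- Seeding the maximum with the head monomial keeps it inside the list in either case of
    -- `argmax-sel`.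
    μ = max μ₀ (map proj₂ f)

    ≼max : All (_≼ μ) (map proj₂ f)
    ≼max = xs≤max μ₀ (map proj₂ f)

    μ∈f : μ ∈ map proj₂ f
    μ∈f with argmax-sel id μ₀ (map proj₂ f)
    ... | inj₁ eq = here eq
    ... | inj₂ μ∈ = μ∈

    top : ∀ {ν} → μ ◁ ν → ¬ (ν ∈ map proj₂ f)
    top (eq , μ≢ν) ν∈f = μ≢ν (antisym (subst (μ ≼_) eq (≼-· μ _)) (All.lookup ≼max ν∈f))

    0<c : 0ℤ ℤ.< coeff f μ
    0<c = coeff-positive f (All.map (λ where
      (inj₁ pos) _    → pos
      (inj₂ any) refl → let t , t∈f , _ , μ◁ν = find any in contradiction (∈-map⁺ proj₂ t∈f) (top μ◁ν)) dom) μ∈f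

  positive-resp-≈ : ∀ {f g} → f ≈ g → HasPositiveLeadingCoeff ord f → HasPositiveLeadingCoeff ord g
  positive-resp-≈ f≈g (c , (c≢0 , μ , eq , top) , 0<c) =
    c , (c≢0 , μ , trans (sym (f≈g μ)) eq , λ ν → top ν ∘ (λ g≢0 → g≢0 ∘ trans (sym (f≈g ν)))) , 0<c

  zero-not-positive : ¬ HasPositiveLeadingCoeff ord []
  zero-not-positive (_ , (c≢0 , _ , eq , _) , _) = c≢0 (sym eq)

  -- A polynomial and its negative have the same support, so by antisymmetry the same leading
  -- monomial, where their coefficients are opposite.
  positive-asymmetric : ∀ {f} → HasPositiveLeadingCoeff ord f → ¬ HasPositiveLeadingCoeff ord (⊟ f)
  positive-asymmetric {f} (c , (c≢0 , μ , eq , top) , 0<c) (d , (d≢0 , ν , eq′ , top′) , 0<d) =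
    ℤ.<-asym 0<c (subst (ℤ._< 0ℤ) -d≡c (ℤ.neg-mono-< 0<d))
    where
    ν≡μ : ν ≡ μ
    ν≡μ = antisym
      (top ν λ f≡0 → d≢0 (trans (sym eq′) (trans (coeff-⊟ f ν) (cong ℤ.-_ f≡0))))
      (top′ μ λ ⊟f≡0 → c≢0 (trans (sym eq) (ℤ.neg-injective (trans (sym (coeff-⊟ f μ)) ⊟f≡0))))
    -d≡c : ℤ.- d ≡ c
    -d≡c = trans (cong ℤ.-_ (trans (sym eq′) (coeff-⊟ f ν)))
      (trans (ℤ.neg-involutive _) (trans (cong (coeff f) ν≡μ) eq))

-- Symbolic templates for the listed polynomials

infixl 6 _:+_
infixl 7 _:*_
infix  8 :-_

⟨_,_,_⟩ : {F : Fin 3 → Set} → F 0F → F 1F → F 2F → ∀ t → F t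
⟨ a , b , c ⟩ 0F = a
⟨ a , b , c ⟩ 1F = b
⟨ a , b , c ⟩ 2F = c

-- The variable v t i is the i-th chosen variable of the part in role t, where the
-- roles 0, 1, 2 are those of u, v, w in OneLarge₃, TwoLarge and OneLarge₂.
data Expr (ar : Vector ℕ 3) : Set where
  lit  : ℤ → Expr ar
  v    : ∀ t → Fin (ar t) → Expr ar
  _:+_ : Expr ar → Expr ar → Expr ar
  _:*_ : Expr ar → Expr ar → Expr ar
  :-_  : Expr ar → Expr ar

Env : Vector ℕ 3 → ℕ → Set
Env ar N = ∀ t → Vector (Poly N) (ar t)

eval : Env ar N → Expr ar → Poly N
eval ρ (lit c)    = const c
eval ρ (v t i)    = ρ t i
eval ρ (e₁ :+ e₂) = eval ρ e₁ ⊞ eval ρ e₂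
eval ρ (e₁ :* e₂) = eval ρ e₁ ⊠ eval ρ e₂
eval ρ (:- e)     = ⊟ eval ρ e

eval-cong : {ρ ρ′ : Env ar N} → (∀ t i → ρ t i ≡ ρ′ t i) → ∀ e → eval ρ e ≡ eval ρ′ e
eval-cong eq (lit c)    = refl
eval-cong eq (v t i)    = eq t i
eval-cong eq (e₁ :+ e₂) = cong₂ _⊞_ (eval-cong eq e₁) (eval-cong eq e₂)
eval-cong eq (e₁ :* e₂) = cong₂ _⊠_ (eval-cong eq e₁) (eval-cong eq e₂)
eval-cong eq (:- e)     = cong ⊟_ (eval-cong eq e)

eval-rename : (θ : p ⊑ q) {ρ : Env ar q} {ρ′ : Env ar p} → (∀ t i → ρ t i ≡ rename θ (ρ′ t i)) →
              ∀ e → eval ρ e ≡ rename θ (eval ρ′ e)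
eval-rename θ eq (lit c)    = sym (rename-const θ c)
eval-rename θ eq (v t i)    = eq t i
eval-rename θ eq (e₁ :+ e₂) =
  trans (cong₂ _⊞_ (eval-rename θ eq e₁) (eval-rename θ eq e₂)) (sym (rename-⊞ θ (eval _ e₁) (eval _ e₂)))
eval-rename θ eq (e₁ :* e₂) =
  trans (cong₂ _⊠_ (eval-rename θ eq e₁) (eval-rename θ eq e₂)) (sym (rename-⊠ θ (eval _ e₁) (eval _ e₂)))
eval-rename θ eq (:- e)     = trans (cong ⊟_ (eval-rename θ eq e)) (sym (rename-⊟ θ (eval _ e)))

-- `arity t` is the number of vertices taken from the part in role `t`. A listed polynomial is a
-- template with an increasing choice of that many vertices for each role, which encodes conditions
-- such as `i₁ < i₂`.
record Template : Set where
  constructor _⊢_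
  field
    arity : Vector ℕ 3
    expr  : Expr arity
open Template

infix 5 _⊢_

oneLarge₃ : Vector Template 3
oneLarge₃ = fromList (
    (⟨ 1 , 0 , 0 ⟩ ⊢ v 0F 0F)
  ∷ (⟨ 2 , 0 , 0 ⟩ ⊢ v 0F 0F :* v 0F 1F)
  ∷ (⟨ 3 , 0 , 0 ⟩ ⊢ v 0F 0F :* v 0F 1F :* v 0F 2F)
  ∷ [])

constantTwo : Vector Template 1
constantTwo = fromList ((⟨ 0 , 0 , 0 ⟩ ⊢ lit (+ 2)) ∷ [])

oneOfEach : Vector Template 1
oneOfEach = fromList (
  (⟨ 1 , 1 , 1 ⟩ ⊢ lit (ℤ.- (+ 2)) :+ :- v 0F 0F :+ :- v 1F 0F :+ :- v 2F 0F :+ v 0F 0F :* v 1F 0F :* v 2F 0F) ∷ [])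

twoLarge : Vector Template 6
twoLarge = fromList (
    (⟨ 1 , 0 , 0 ⟩ ⊢ v 0F 0F)
  ∷ (⟨ 0 , 1 , 0 ⟩ ⊢ v 1F 0F)
  ∷ (⟨ 0 , 0 , 1 ⟩ ⊢ v 2F 0F :+ lit (+ 2))
  ∷ (⟨ 2 , 0 , 0 ⟩ ⊢ v 0F 0F :+ v 0F 1F)
  ∷ (⟨ 0 , 2 , 0 ⟩ ⊢ v 1F 0F :+ v 1F 1F)
  ∷ (⟨ 1 , 1 , 0 ⟩ ⊢ v 0F 0F :* v 1F 0F)
  ∷ [])

oneLarge₂ : Vector Template 6
oneLarge₂ = fromList (
    (⟨ 0 , 1 , 1 ⟩ ⊢ v 1F 0F :+ v 2F 0F :+ lit (+ 2))
  ∷ (⟨ 1 , 1 , 0 ⟩ ⊢ v 0F 0F :* (v 1F 0F :+ lit (+ 1)))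
  ∷ (⟨ 1 , 0 , 1 ⟩ ⊢ v 0F 0F :* (v 2F 0F :+ lit (+ 1)))
  ∷ (⟨ 2 , 0 , 0 ⟩ ⊢ v 0F 0F :* v 0F 1F :+ v 0F 0F :+ v 0F 1F)
  ∷ (⟨ 2 , 1 , 0 ⟩ ⊢ v 0F 0F :* v 0F 1F :* v 1F 0F :+ :- v 0F 0F :+ :- v 0F 1F)
  ∷ (⟨ 2 , 0 , 1 ⟩ ⊢ v 0F 0F :* v 0F 1F :* v 2F 0F :+ :- v 0F 0F :+ :- v 0F 1F)
  ∷ [])

-- Three fields rather than a function on `Fin 3`, so that membership in the enumeration `choices`
-- holds for propositional equality.
record Choice (ar P : Vector ℕ 3) : Set where
  constructor choice
  field
    at₀ : ar 0F ⊑ P 0F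
    at₁ : ar 1F ⊑ P 1F
    at₂ : ar 2F ⊑ P 2F

at : Choice ar P → ∀ t → ar t ⊑ P t
at (choice θ η ζ) = ⟨ θ , η , ζ ⟩

choices : ∀ ar P → List (Choice ar P)
choices ar P = cartesianProductWith (λ θ (η , ζ) → choice θ η ζ)
  (thinnings _ _) (cartesianProduct (thinnings _ _) (thinnings _ _))

∈-choices : (θ : Choice ar P) → θ ∈ choices ar P
∈-choices (choice θ η ζ) = ∈-cartesianProductWith⁺ _
  (∈-thinnings θ) (∈-cartesianProduct⁺ (∈-thinnings η) (∈-thinnings ζ))

instantiate : (∀ t → Vector (Poly N) (P t)) → (τ : Template) → Choice (arity τ) P → Poly N
instantiate U τ θ = eval (λ t i → U t (⟦ at θ t ⟧ i)) (expr τ)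

-- The argument of u≥3 and u≥2 is the part in the role of u, that of u,v≥2 the part
-- in the role of w; the remaining parts take the remaining roles in order.
data Kind : Set where
  u≥3   : Fin 3 → Kind
  all≥2 : Kind
  all≥1 : Kind
  u,v≥2 : Fin 3 → Kind
  u≥2   : Fin 3 → Kind

kinds : List Kind
kinds = all≥2 ∷ all≥1 ∷ map u≥3 (allFin 3) List.++ map u,v≥2 (allFin 3) List.++ map u≥2 (allFin 3)

count : Kind → ℕ
count (u≥3 _)   = 3
count all≥2     = 1
count all≥1     = 1
count (u,v≥2 _) = 6
count (u≥2 _)   = 6

templates : ∀ κ → Vector Template (count κ)
templates (u≥3 _)   = oneLarge₃
templates all≥2     = constantTwo
templates all≥1     = oneOfEach
templates (u,v≥2 _) = twoLarge
templates (u≥2 _)   = oneLarge₂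

-- A permutation rather than a mere function, because `choose` has to convert data given for each
-- role into data given for each part.
arrangement : Kind → Permutation′ 3
arrangement (u≥3 u)   = insert 0F u Perm.id
arrangement all≥2     = Perm.id
arrangement all≥1     = Perm.id
arrangement (u,v≥2 w) = insert 2F w Perm.id
arrangement (u≥2 u)   = insert 0F u Perm.id

part : Kind → Fin 3 → Fin 3
part κ = arrangement κ ⟨$⟩ʳ_

minSize : Kind → Vector ℕ 3
minSize (u≥3 u)   = updateAt (replicate 3 1) u λ _ → 3
minSize all≥2     = replicate 3 2
minSize all≥1     = replicate 3 1
minSize (u,v≥2 w) = updateAt (replicate 3 2) w λ _ → 1
minSize (u≥2 u)   = updateAt (replicate 3 1) u λ _ → 2

total : Vector ℕ 3 → ℕ
total D = size (D 0F) (D 1F) (D 2F)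

vars : ∀ D p → Vector (Poly (total D)) (D p)
vars D = ⟨ xs m n o , ys m n o , zs m n o ⟩
  where m = D 0F; n = D 1F; o = D 2F

inRole : ∀ κ D t → Vector (Poly (total D)) (D (part κ t))
inRole κ D t = vars D (part κ t)

laplacian : ∀ D → Matrix (total D) (total D) (total D)
laplacian D = L (D 0F) (D 1F) (D 2F)

item : ∀ κ D (i : Fin (count κ)) → Choice (arity (templates κ i)) (D ∘ part κ) → Poly (total D)
item κ D i θ = instantiate (inRole κ D) (templates κ i) θ

Instance : ∀ {n} → Vector Template n → (∀ t → Vector (Poly N) (P t)) → Poly N → Set
Instance F U g = ∃[ i ] Σ[ θ ∈ Choice (arity (F i)) _ ] g ≡ instantiate U (F i) θ

-- The vertices met by a minor may miss a part altogether, but that part still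
-- has a vertex in the whole graph: hence D p ⊔ 1.
IsCandidate : ∀ D → Poly (total D) → Set
IsCandidate D g =
  Σ[ κ ∈ Kind ] (∀ p → minSize κ p ≤ D p ⊔ 1) × Instance (templates κ) (inRole κ D) g

-- Each polynomial carries the evidence of its origin, so a Boolean search that succeeds at it also
-- supplies the proof of `IsCandidate`.
candidates : ∀ D → List (∃[ g ] IsCandidate D g)
candidates D = List.concatMap ofKind kinds
  where
  ofKind : Kind → List (∃[ g ] IsCandidate D g)
  ofKind κ with Fin.all? (λ p → minSize κ p ℕ.≤? D p ⊔ 1)
  ... | no  _ = []
  ... | yes b = List.concatMap (λ i → map (λ θ → item κ D i θ , κ , b , i , θ , refl)
                                          (choices (arity (templates κ i)) (D ∘ part κ)))
                               (allFin (count κ))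

-- Boolean tests on minors, to be run by evaluation

minor : ∀ {N q} → Matrix N q q → 3 ⊑ q → 3 ⊑ q → Poly N
minor A θ η = det λ a b → A (⟦ θ ⟧ a) (⟦ η ⟧ b)

all-lookup : (P : A → Bool) (xs : List A) → all P xs ≡ true → ∀ {x} → x ∈ xs → P x ≡ true
all-lookup P xs eq x∈xs =
  Equivalence.to T-≡ (All.lookup (All.all⁺ P xs (Equivalence.from T-≡ eq)) x∈xs)

does-true : (A? : Dec A) → does A? ≡ true → A
does-true (yes a) _ = a

any-witness : (P : A → Bool) (xs : List A) → any P xs ≡ true → ∃[ x ] P x ≡ true
any-witness P xs eq =
  Product.map₂ (Equivalence.to T-≡) (Any.satisfied (Any.any⁻ P xs (Equivalence.from T-≡ eq)))

∧-true : ∀ a {b} → a ∧ b ≡ true → a ≡ true × b ≡ true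
∧-true true eq = refl , eq

∨-true : ∀ a {b} → a ∨ b ≡ true → a ≡ true ⊎ b ≡ true
∨-true true  _  = inj₁ refl
∨-true false eq = inj₂ eq

-- The lengths are compared only to reject most pairs cheaply.
agree± : Poly N → Poly N → Bool
agree± f g = (List.length f ℕ.≡ᵇ List.length g) ∧ (agree f g ∨ agree f (⊟ g))

coverMinor : ∀ D → Cover 3 3 (total D) → Poly (total D)
coverMinor D c = simplify (minor (laplacian D) (left⊑ c) (right⊑ c))

-- The candidates are an argument, and the minor is bound by a λ, so that they are
-- shared during evaluation.
classified : ∀ D → List (∃[ g ] IsCandidate D g) → Cover 3 3 (total D) → Bool
classified D gs c = (λ f → null f ∨ any (λ g → agree± f (proj₁ g)) gs) (coverMinor D c)

minorsClassified : ∀ D → List (∃[ g ] IsCandidate D g) → Bool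
minorsClassified D gs = all (classified D gs) (covers 3 3 (total D))

matchesMinor : ∀ D → Poly (total D) → 3 ⊑ total D → 3 ⊑ total D → Bool
matchesMinor D g θ η = agree± (simplify (minor (laplacian D) θ η)) g

matches : ∀ D → Poly (total D) → Bool
matches D g = any (λ θ → any (matchesMinor D g θ) (thinnings 3 (total D))) (thinnings 3 (total D))

-- Translation between templates and the stated list

module _ (U : ∀ t → Vector (Poly N) (P t)) where

  instantiate-OneLarge₃ : ∀ i (θ : Choice (arity (oneLarge₃ i)) P) →
                       OneLarge₃ (U 0F) (instantiate U (oneLarge₃ i) θ)
  instantiate-OneLarge₃ 0F _              = u₁ _
  instantiate-OneLarge₃ 1F (choice θ _ _) = u₁u₂ (⟦⟧-increasing θ (s≤s z≤n))
  instantiate-OneLarge₃ 2F (choice θ _ _) =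
    u₁u₂u₃ (⟦⟧-increasing θ (s≤s z≤n)) (⟦⟧-increasing θ (s≤s (s≤s z≤n)))

  instantiate-TwoLarge : ∀ i (θ : Choice (arity (twoLarge i)) P) →
                      TwoLarge (U 0F) (U 1F) (U 2F) (instantiate U (twoLarge i) θ)
  instantiate-TwoLarge 0F _              = u₁ _
  instantiate-TwoLarge 1F _              = v₁ _
  instantiate-TwoLarge 2F _              = w₁+2 _
  instantiate-TwoLarge 3F (choice θ _ _) = u₁+u₂ (⟦⟧-increasing θ (s≤s z≤n))
  instantiate-TwoLarge 4F (choice _ θ _) = v₁+v₂ (⟦⟧-increasing θ (s≤s z≤n))
  instantiate-TwoLarge 5F _              = u₁v₁ _ _

  instantiate-OneLarge₂ : ∀ i (θ : Choice (arity (oneLarge₂ i)) P) →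
                       OneLarge₂ (U 0F) (U 1F) (U 2F) (instantiate U (oneLarge₂ i) θ)
  instantiate-OneLarge₂ 0F _              = v+w+2 _ _
  instantiate-OneLarge₂ 1F _              = u[v+1] _ _
  instantiate-OneLarge₂ 2F _              = u[w+1] _ _
  instantiate-OneLarge₂ 3F (choice θ _ _) = u₁u₂+u₁+u₂ (⟦⟧-increasing θ (s≤s z≤n))
  instantiate-OneLarge₂ 4F (choice θ _ _) = u₁u₂v-u₁-u₂ (⟦⟧-increasing θ (s≤s z≤n)) _
  instantiate-OneLarge₂ 5F (choice θ _ _) = u₁u₂w-u₁-u₂ (⟦⟧-increasing θ (s≤s z≤n)) _

Increasing : ℕ → ℕ → Set
Increasing p q = Σ[ s ∈ Vector (Fin q) p ] StrictlyIncreasing s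

none : Increasing 0 q
none = (λ ()) , λ {}

cons : (i : Fin q) (s : Increasing p q) → (∀ a → i < proj₁ s a) → Increasing (suc p) q
cons {q} {p} i (s , s-increasing) i<s = i∷s , i∷s-increasing
  where
  i∷s : Vector (Fin q) (suc p)
  i∷s zero    = i
  i∷s (suc a) = s a

  i∷s-increasing : StrictlyIncreasing i∷s
  i∷s-increasing {zero}  {suc b} _         = i<s b
  i∷s-increasing {suc a} {suc b} (s≤s a<b) = s-increasing a<b

single : Fin q → Increasing 1 q
single i = cons i none λ ()

pair : {i j : Fin q} → i < j → Increasing 2 q
pair {i = i} {j} i<j = cons i (single j) λ { 0F → i<j }

triple : {i j k : Fin q} → i < j → j < k → Increasing 3 q
triple {i = i} i<j j<k = cons i (pair j<k) λ { 0F → i<j ; 1F → ℕ.<-trans i<j j<k }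

module _ (U : ∀ t → Vector (Poly N) (P t)) where

  evalInstance : ∀ {n} (F : Vector Template n) i →
    (s₀ : Increasing (arity (F i) 0F) (P 0F)) (s₁ : Increasing (arity (F i) 1F) (P 1F))
    (s₂ : Increasing (arity (F i) 2F) (P 2F)) →
    Instance F U (eval ⟨ U 0F ∘ proj₁ s₀ , U 1F ∘ proj₁ s₁ , U 2F ∘ proj₁ s₂ ⟩ (expr (F i)))
  evalInstance F i (s₀ , inc₀) (s₁ , inc₁) (s₂ , inc₂)
    with θ₀ , eq₀ ← fromIncreasing s₀ inc₀
       | θ₁ , eq₁ ← fromIncreasing s₁ inc₁
       | θ₂ , eq₂ ← fromIncreasing s₂ inc₂ =
    i , choice θ₀ θ₁ θ₂ , eval-cong (λ where
      0F a → cong (U 0F) (sym (eq₀ a))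
      1F a → cong (U 1F) (sym (eq₁ a))
      2F a → cong (U 2F) (sym (eq₂ a))) (expr (F i))

  OneLarge₃⇒Instance : ∀ {g} → OneLarge₃ (U 0F) g → Instance oneLarge₃ U g
  OneLarge₃⇒Instance (u₁ i)           = evalInstance oneLarge₃ 0F (single i) none none
  OneLarge₃⇒Instance (u₁u₂ i<j)       = evalInstance oneLarge₃ 1F (pair i<j) none none
  OneLarge₃⇒Instance (u₁u₂u₃ i<j j<k) = evalInstance oneLarge₃ 2F (triple i<j j<k) none none

  TwoLarge⇒Instance : ∀ {g} → TwoLarge (U 0F) (U 1F) (U 2F) g → Instance twoLarge U g
  TwoLarge⇒Instance (u₁ i)      = evalInstance twoLarge 0F (single i) none none
  TwoLarge⇒Instance (v₁ j)      = evalInstance twoLarge 1F none (single j) none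
  TwoLarge⇒Instance (w₁+2 k)    = evalInstance twoLarge 2F none none (single k)
  TwoLarge⇒Instance (u₁+u₂ i<j) = evalInstance twoLarge 3F (pair i<j) none none
  TwoLarge⇒Instance (v₁+v₂ i<j) = evalInstance twoLarge 4F none (pair i<j) none
  TwoLarge⇒Instance (u₁v₁ i j)  = evalInstance twoLarge 5F (single i) (single j) none

  OneLarge₂⇒Instance : ∀ {g} → OneLarge₂ (U 0F) (U 1F) (U 2F) g → Instance oneLarge₂ U g
  OneLarge₂⇒Instance (v+w+2 j k)           = evalInstance oneLarge₂ 0F none (single j) (single k)
  OneLarge₂⇒Instance (u[v+1] i j)          = evalInstance oneLarge₂ 1F (single i) (single j) none
  OneLarge₂⇒Instance (u[w+1] i k)          = evalInstance oneLarge₂ 2F (single i) none (single k)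
  OneLarge₂⇒Instance (u₁u₂+u₁+u₂ i<j)      = evalInstance oneLarge₂ 3F (pair i<j) none none
  OneLarge₂⇒Instance (u₁u₂v-u₁-u₂ i<j j)   = evalInstance oneLarge₂ 4F (pair i<j) (single j) none
  OneLarge₂⇒Instance (u₁u₂w-u₁-u₂ i<j k)   = evalInstance oneLarge₂ 5F (pair i<j) none (single k)

infix 4 _≤̇_
_≤̇_ : Vector ℕ 3 → Vector ℕ 3 → Set
D ≤̇ E = ∀ p → D p ≤ E p

IsListed : ∀ D → Poly (total D) → Set
IsListed D = Listed (D 0F) (D 1F) (D 2F)

item-listed : ∀ κ → minSize κ ≤̇ D → ∀ i θ → IsListed D (item κ D i θ)
item-listed (u≥3 0F)   b i θ = m≥3 (b 0F) (instantiate-OneLarge₃ (inRole (u≥3 0F) _) i θ)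
item-listed (u≥3 1F)   b i θ = n≥3 (b 1F) (instantiate-OneLarge₃ (inRole (u≥3 1F) _) i θ)
item-listed (u≥3 2F)   b i θ = o≥3 (b 2F) (instantiate-OneLarge₃ (inRole (u≥3 2F) _) i θ)
item-listed all≥2      b 0F θ = two (b 0F) (b 1F) (b 2F)
item-listed all≥1      b 0F θ = xyz _ _ _
item-listed (u,v≥2 0F) b i θ = n,o≥2 (b 1F) (b 2F) (instantiate-TwoLarge (inRole (u,v≥2 0F) _) i θ)
item-listed (u,v≥2 1F) b i θ = m,o≥2 (b 0F) (b 2F) (instantiate-TwoLarge (inRole (u,v≥2 1F) _) i θ)
item-listed (u,v≥2 2F) b i θ = m,n≥2 (b 0F) (b 1F) (instantiate-TwoLarge (inRole (u,v≥2 2F) _) i θ)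
item-listed (u≥2 0F)   b i θ = m≥2 (b 0F) (instantiate-OneLarge₂ (inRole (u≥2 0F) _) i θ)
item-listed (u≥2 1F)   b i θ = n≥2 (b 1F) (instantiate-OneLarge₂ (inRole (u≥2 1F) _) i θ)
item-listed (u≥2 2F)   b i θ = o≥2 (b 2F) (instantiate-OneLarge₂ (inRole (u≥2 2F) _) i θ)

IsItem : ∀ D → Poly (total D) → Set
IsItem D g = Σ[ κ ∈ Kind ] minSize κ ≤̇ D × Instance (templates κ) (inRole κ D) g

-- The constructors of `Listed` bound only the distinguished parts, whereas `minSize` bounds all
-- three; nonemptiness of the parts supplies the other bounds.
listed-item : ∀ {g} → (∀ p → 1 ≤ D p) → IsListed D g → IsItem D g
listed-item 1≤D (m≥3 b x) = u≥3 0F , ⟨ b , 1≤D 1F , 1≤D 2F ⟩ , OneLarge₃⇒Instance (inRole (u≥3 0F) _) x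
listed-item 1≤D (n≥3 b x) = u≥3 1F , ⟨ 1≤D 0F , b , 1≤D 2F ⟩ , OneLarge₃⇒Instance (inRole (u≥3 1F) _) x
listed-item 1≤D (o≥3 b x) = u≥3 2F , ⟨ 1≤D 0F , 1≤D 1F , b ⟩ , OneLarge₃⇒Instance (inRole (u≥3 2F) _) x
listed-item 1≤D (two a b c) = all≥2 , ⟨ a , b , c ⟩ ,
  evalInstance (inRole all≥2 _) constantTwo 0F none none none
listed-item 1≤D (xyz i j k) = all≥1 , ⟨ 1≤D 0F , 1≤D 1F , 1≤D 2F ⟩ ,
  evalInstance (inRole all≥1 _) oneOfEach 0F (single i) (single j) (single k)
listed-item 1≤D (m,n≥2 a b x) = u,v≥2 2F , ⟨ a , b , 1≤D 2F ⟩ , TwoLarge⇒Instance (inRole (u,v≥2 2F) _) x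
listed-item 1≤D (m,o≥2 a b x) = u,v≥2 1F , ⟨ a , 1≤D 1F , b ⟩ , TwoLarge⇒Instance (inRole (u,v≥2 1F) _) x
listed-item 1≤D (n,o≥2 a b x) = u,v≥2 0F , ⟨ 1≤D 0F , a , b ⟩ , TwoLarge⇒Instance (inRole (u,v≥2 0F) _) x
listed-item 1≤D (m≥2 b x) = u≥2 0F , ⟨ b , 1≤D 1F , 1≤D 2F ⟩ , OneLarge₂⇒Instance (inRole (u≥2 0F) _) x
listed-item 1≤D (n≥2 b x) = u≥2 1F , ⟨ 1≤D 0F , b , 1≤D 2F ⟩ , OneLarge₂⇒Instance (inRole (u≥2 1F) _) x
listed-item 1≤D (o≥2 b x) = u≥2 2F , ⟨ 1≤D 0F , 1≤D 1F , b ⟩ , OneLarge₂⇒Instance (inRole (u≥2 2F) _) x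

-- Transport along embeddings of the parts, and equality up to sign

block : (∀ p → D′ p ⊑ D p) → total D′ ⊑ total D
block Θ = Θ 0F ⊕ Θ 1F ⊕ Θ 2F

laplacian-rename : (Θ : ∀ p → D′ p ⊑ D p) → ∀ i j →
  laplacian D (⟦ block Θ ⟧ i) (⟦ block Θ ⟧ j) ≡ rename (block Θ) (laplacian D′ i j)
laplacian-rename Θ = L-rename (Θ 0F) (Θ 1F) (Θ 2F)

vars-rename : (Θ : ∀ p → D′ p ⊑ D p) → ∀ p i →
              vars D p (⟦ Θ p ⟧ i) ≡ rename (block Θ) (vars D′ p i)
vars-rename Θ = ⟨ xs-rename (Θ 0F) (Θ 1F) (Θ 2F)
                , ys-rename (Θ 0F) (Θ 1F) (Θ 2F)
                , zs-rename (Θ 0F) (Θ 1F) (Θ 2F) ⟩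

item-rename : ∀ κ (Θ : ∀ p → D′ p ⊑ D p) i θ θ′ →
  (∀ t a → ⟦ at θ t ⟧ a ≡ ⟦ Θ (part κ t) ⟧ (⟦ at θ′ t ⟧ a)) →
  item κ D i θ ≡ rename (block Θ) (item κ D′ i θ′)
item-rename {D = D} κ Θ i θ θ′ eq = eval-rename (block Θ)
  (λ t a → trans (cong (inRole κ D t) (eq t a)) (vars-rename Θ (part κ t) _))
  (expr (templates κ i))

minor-rename : (Θ : ∀ p → D′ p ⊑ D p) (θ η : 3 ⊑ total D′) →
  minor (laplacian D) (block Θ ⊙ θ) (block Θ ⊙ η) ≡ rename (block Θ) (minor (laplacian D′) θ η)
minor-rename {D′ = D′} {D = D} Θ θ η = trans
  (det-cong λ a b → trans (cong₂ (laplacian D) (⟦⊙⟧ (block Θ) θ a) (⟦⊙⟧ (block Θ) η b)) (laplacian-rename Θ _ _))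
  (det-rename (block Θ) λ a b → laplacian D′ (⟦ θ ⟧ a) (⟦ η ⟧ b))

data _≈±_ (f g : Poly N) : Set where
  plus  : f ≈ g → f ≈± g
  minus : f ≈ ⊟ g → f ≈± g

≈±-respˡ : {f f′ g : Poly N} → f ≈ f′ → f′ ≈± g → f ≈± g
≈±-respˡ f≈f′ (plus f′≈g)   = plus λ μ → trans (f≈f′ μ) (f′≈g μ)
≈±-respˡ f≈f′ (minus f′≈⊟g) = minus λ μ → trans (f≈f′ μ) (f′≈⊟g μ)

⊟-≈-swap : (f g : Poly N) → ⊟ f ≈ g → f ≈ ⊟ g
⊟-≈-swap f g eq μ = ℤ.neg-injective (trans (sym (coeff-⊟ f μ))
  (trans (eq μ) (trans (sym (ℤ.neg-involutive (coeff g μ))) (cong ℤ.-_ (sym (coeff-⊟ g μ))))))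

⊟-injective : (f g : Poly N) → ⊟ f ≈ ⊟ g → f ≈ g
⊟-injective f g eq μ = ℤ.neg-injective (trans (sym (coeff-⊟ f μ)) (trans (eq μ) (coeff-⊟ g μ)))

≈±-⊟ˡ : {f g : Poly N} → ⊟ f ≈± g → f ≈± g
≈±-⊟ˡ {f = f} {g} (plus eq)  = minus (⊟-≈-swap f g eq)
≈±-⊟ˡ {f = f} {g} (minus eq) = plus (⊟-injective f g eq)

agree±-sound : (θ : p ⊑ q) (f g : Poly p) → agree± f g ≡ true → rename θ f ≈± rename θ g
agree±-sound θ f g eq with ∨-true (agree f g) (proj₂ (∧-true (List.length f ℕ.≡ᵇ List.length g) eq))
... | inj₁ eq₁ = plus (agree-sound θ f g eq₁)
... | inj₂ eq₂ = minus (subst (rename θ f ≈_) (rename-⊟ θ g) (agree-sound θ f (⊟ g) eq₂))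

simplify-rename : (θ : p ⊑ q) (f : Poly p) → rename θ (simplify f) ≈ rename θ f
simplify-rename θ = coeff-simplify (insertZeros θ)

minor-simplify-rename : (Θ : ∀ p → D′ p ⊑ D p) (θ η : 3 ⊑ total D′) →
  minor (laplacian D) (block Θ ⊙ θ) (block Θ ⊙ η) ≈ rename (block Θ) (simplify (minor (laplacian D′) θ η))
minor-simplify-rename {D′ = D′} {D = D} Θ θ η μ = trans
  (cong (λ g → coeff g μ) (minor-rename {D = D} Θ θ η))
  (sym (simplify-rename (block {D = D} Θ) (minor (laplacian D′) θ η) μ))

-- Every minor is zero or listed up to sign

-- Three rows and three columns meet at most six vertices.
below7 : (ℕ → Bool) → Bool
below7 P = all P (upTo 7)

below7-sound : ∀ (P : ℕ → Bool) → below7 P ≡ true → ∀ {k} → k ≤ 6 → P k ≡ true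
below7-sound P eq k≤6 = all-lookup P (upTo 7) eq (∈-upTo⁺ (s≤s k≤6))

classified₃ : ℕ → ℕ → ℕ → Bool
classified₃ a b c = minorsClassified ⟨ a , b , c ⟩ (candidates ⟨ a , b , c ⟩)

classified₂ : ℕ → ℕ → Bool
classified₂ a b = below7 (classified₃ a b)

classified₁ : ℕ → Bool
classified₁ a = below7 (classified₂ a)

-- An equation with true rather than T, which the type checker would unfold, and
-- hence run, at each use.
all-classified : below7 classified₁ ≡ true
all-classified = refl

-- The evaluated check ranges over the whole cube of sizes up to 6 for each part. Triples with sum
-- above 6 pass vacuously, since `covers 3 3` is empty for them.
minorsClassified-small : ∀ a b c → size a b c ≤ 6 → classified₃ a b c ≡ true
minorsClassified-small a b c ≤6 =
  below7-sound (classified₃ a b)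
    (below7-sound (classified₂ a) (below7-sound classified₁ all-classified a≤6) b≤6) c≤6
  where
  b+c≤6 = ℕ.≤-trans (ℕ.m≤n+m (b ℕ.+ c) a) ≤6
  a≤6 = ℕ.≤-trans (ℕ.m≤m+n a (b ℕ.+ c)) ≤6
  b≤6 = ℕ.≤-trans (ℕ.m≤m+n b c) b+c≤6
  c≤6 = ℕ.≤-trans (ℕ.m≤n+m c b) b+c≤6

cover-classified : ∀ a b c (κ : Cover 3 3 (size a b c)) →
  classified ⟨ a , b , c ⟩ (candidates ⟨ a , b , c ⟩) κ ≡ true
cover-classified a b c κ =
  all-lookup (classified ⟨ a , b , c ⟩ (candidates ⟨ a , b , c ⟩)) (covers 3 3 (size a b c))
    (minorsClassified-small a b c (Cover⇒≤ κ)) (∈-covers κ)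

candidate-listed : ∀ {g} (Θ : ∀ p → D′ p ⊑ D p) → (∀ p → 1 ≤ D p) → IsCandidate D′ g →
                   IsListed D (rename (block Θ) g)
candidate-listed {D = D} Θ 1≤D (κ , b , i , θ@(choice θ₀ θ₁ θ₂) , refl) = subst (IsListed D)
  (item-rename κ Θ i θ″ θ ⟨ ⟦⊙⟧ (Θ (part κ 0F)) θ₀ , ⟦⊙⟧ (Θ (part κ 1F)) θ₁ , ⟦⊙⟧ (Θ (part κ 2F)) θ₂ ⟩)
  -- Both `D′ p` and 1 are at most `D p`, so the weakened bound `D′ p ⊔ 1` of a candidate gives the
  -- bound required in the full graph.
  (item-listed κ (λ p → ℕ.≤-trans (b p) (ℕ.⊔-lub (⊑⇒≤ (Θ p)) (1≤D p))) i θ″)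
  where
  θ″ : Choice (arity (templates κ i)) (D ∘ part κ)
  θ″ = choice (Θ (part κ 0F) ⊙ θ₀) (Θ (part κ 1F) ⊙ θ₁) (Θ (part κ 2F) ⊙ θ₂)

IsClassified : ∀ D → Poly (total D) → Set
IsClassified D f = f ≈ [] ⊎ ∃[ g ] IsListed D g × f ≈± g

cover-minor-classified : ∀ a b c (Θ : ∀ p → ⟨ a , b , c ⟩ p ⊑ D p) → (∀ p → 1 ≤ D p) →
  (κ : Cover 3 3 (size a b c)) → IsClassified D (minor (laplacian D) (block Θ ⊙ left⊑ κ) (block Θ ⊙ right⊑ κ))
cover-minor-classified {D = D} a b c Θ 1≤D κ = result (∨-true (null g′) (cover-classified a b c κ))
  where
  ι : size a b c ⊑ total D
  ι = block {D = D} Θ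
  E = ⟨ a , b , c ⟩
  f = minor (laplacian D) (ι ⊙ left⊑ κ) (ι ⊙ right⊑ κ)
  g′ = coverMinor E κ

  f≈ : f ≈ rename ι g′
  f≈ = minor-simplify-rename Θ (left⊑ κ) (right⊑ κ)

  result : null g′ ≡ true ⊎ any (λ g → agree± g′ (proj₁ g)) (candidates E) ≡ true → IsClassified D f
  result (inj₁ null) = inj₁ (subst (λ g → f ≈ rename ι g) (null⇒≡[] null) f≈)
  result (inj₂ some) =
    let (g , g-candidate) , eq = any-witness (λ g → agree± g′ (proj₁ g)) (candidates E) some in
    inj₂ (rename ι g , candidate-listed Θ 1≤D g-candidate ,
      ≈±-respˡ {f = f} {rename ι g′} f≈ (agree±-sound ι g′ g eq))

-- Rows and columns factor through the set `ι` of vertices they meet, and splitting `ι` at the part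
-- boundaries exhibits it as a block embedding. The minor thus comes from a graph with parts of
-- sizes `a`, `b`, `c`.
minor-classified : ∀ D → (∀ p → 1 ≤ D p) → (θ η : 3 ⊑ total D) → IsClassified D (minor (laplacian D) θ η)
minor-classified D 1≤D θ η
  with _ , κ , ι , refl , refl ← cover θ η
  with _and_ {p = a} ι₀ ι′ ← split (D 0F) ι
  with _and_ {p = b} {p′ = c} ι₁ ι₂ ← split (D 1F) ι′
  = cover-minor-classified a b c ⟨ ι₀ , ι₁ , ι₂ ⟩ 1≤D κ

-- Every listed polynomial is a minor up to sign, with positive leading coefficient

choose : (σ : Permutation′ 3) {F : Fin 3 → Set} {R : ∀ t → F (σ ⟨$⟩ʳ t) → Set} →
         (∀ t → Σ[ x ∈ F (σ ⟨$⟩ʳ t) ] R t x) → Σ[ f ∈ (∀ p → F p) ] ∀ t → R t (f (σ ⟨$⟩ʳ t))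
choose σ {F} {R} xs = (λ p → subst F (inverseʳ σ) (proj₁ (xs (σ ⟨$⟩ˡ p)))) , λ t → transport (inverseˡ σ) (inverseʳ σ)
  where
  -- `eq` is kept general: once `s ≡ t` has been matched it is an equation of a point with itself,
  -- hence `refl` by axiom K.
  transport : ∀ {s t} → s ≡ t → (eq : σ ⟨$⟩ʳ s ≡ σ ⟨$⟩ʳ t) → R t (subst F eq (proj₁ (xs s)))
  transport {s} refl refl = proj₂ (xs s)

∈-kinds : ∀ κ → κ ∈ kinds
∈-kinds all≥2     = here refl
∈-kinds all≥1     = there (here refl)
∈-kinds (u≥3 u)   = there (there (∈-++⁺ˡ (∈-map⁺ u≥3 (∈-allFin u))))
∈-kinds (u,v≥2 w) = there (there (∈-++⁺ʳ (map u≥3 (allFin 3)) (∈-++⁺ˡ (∈-map⁺ u,v≥2 (∈-allFin w)))))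
∈-kinds (u≥2 u)   = there (there (∈-++⁺ʳ (map u≥3 (allFin 3))
                      (∈-++⁺ʳ (map u,v≥2 (allFin 3)) (∈-map⁺ u≥2 (∈-allFin u)))))

arity≤minSize : ∀ κ i t → arity (templates κ i) t ≤ minSize κ (part κ t)
arity≤minSize κ = All.lookup (toWitness {a? = All.all? fits? kinds} tt) (∈-kinds κ)
  where
  fits? : ∀ κ → Dec (∀ i t → arity (templates κ i) t ≤ minSize κ (part κ t))
  fits? κ = Fin.all? λ i → Fin.all? λ t → arity (templates κ i) t ℕ.≤? minSize κ (part κ t)

-- An item uses at most `minSize κ` vertices of each part, and `extend` enlarges these to exactly
-- that many. Only the finitely many items of the smallest graph of each kind remain to be realised.
-- The enlargement is made for each role but the subgraph is given by parts, hence `choose`.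
compress : ∀ κ → minSize κ ≤̇ D → ∀ i (θ : Choice (arity (templates κ i)) (D ∘ part κ)) →
  Σ[ Θ ∈ (∀ p → minSize κ p ⊑ D p) ] Σ[ θ′ ∈ Choice (arity (templates κ i)) (minSize κ ∘ part κ) ]
  item κ D i θ ≡ rename (block Θ) (item κ (minSize κ) i θ′)
compress {D = D} κ b i θ
  with Θ , h ← choose (arrangement κ) {λ p → minSize κ p ⊑ D p}
         {λ t q → Σ[ η ∈ arity (templates κ i) t ⊑ minSize κ (part κ t) ] ⟦ q ⟧ ∘ ⟦ η ⟧ ≗ ⟦ at θ t ⟧}
         (λ t → extend (at θ t) (arity≤minSize κ i t) (b (part κ t)))
  = Θ , θ′ , item-rename κ Θ i θ θ′ ⟨ sym ∘ proj₂ (h 0F) , sym ∘ proj₂ (h 1F) , sym ∘ proj₂ (h 2F) ⟩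
  where θ′ = choice (proj₁ (h 0F)) (proj₁ (h 1F)) (proj₁ (h 2F))

-- Nonemptiness is tested as well because the empty list is vacuously dominated.
realised : ∀ D → Poly (total D) → Bool
realised D g = matches D g ∧ does (dominated? g) ∧ not (null g)

choiceRealised : ∀ κ i → Choice (arity (templates κ i)) (minSize κ ∘ part κ) → Bool
choiceRealised κ i θ = realised (minSize κ) (item κ (minSize κ) i θ)

templateRealised : ∀ κ → Fin (count κ) → Bool
templateRealised κ i = all (choiceRealised κ i) (choices (arity (templates κ i)) (minSize κ ∘ part κ))

kindRealised : Kind → Bool
kindRealised κ = all (templateRealised κ) (allFin (count κ))

all-realised : all kindRealised kinds ≡ true
all-realised = refl

IsSignedMinor : ∀ D → Poly (total D) → Set
IsSignedMinor D g = Σ[ θ ∈ 3 ⊑ total D ] Σ[ η ∈ 3 ⊑ total D ]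
  minor (laplacian D) θ η ≈± g

matches-sound : (Θ : ∀ p → D′ p ⊑ D p) (g : Poly (total D′)) → matches D′ g ≡ true →
                IsSignedMinor D (rename (block Θ) g)
matches-sound {D′ = D′} {D = D} Θ g eq =
  let θ , eq₁ = any-witness (λ θ → any (matchesMinor D′ g θ) (thinnings 3 (total D′))) (thinnings 3 (total D′)) eq
      η , eq₂ = any-witness (matchesMinor D′ g θ) (thinnings 3 (total D′)) eq₁
      f′ = minor (laplacian D′) θ η
      f = minor (laplacian D) (ι ⊙ θ) (ι ⊙ η)
  in ι ⊙ θ , ι ⊙ η ,
     ≈±-respˡ {f = f} {rename ι (simplify f′)} (minor-simplify-rename Θ θ η) (agree±-sound ι (simplify f′) g eq₂)
  where
  ι : total D′ ⊑ total D
  ι = block {D = D} Θ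

item-realised : ∀ κ i θ → choiceRealised κ i θ ≡ true
item-realised κ i θ = all-lookup (choiceRealised κ i) _
  (all-lookup (templateRealised κ) _ (all-lookup kindRealised kinds all-realised (∈-kinds κ)) (∈-allFin i))
  (∈-choices θ)

rename-nonempty : (θ : p ⊑ q) (f : Poly p) → not (null f) ≡ true → rename θ f ≢ []
rename-nonempty θ (_ ∷ _) _ ()

realised-sound : (Θ : ∀ p → D′ p ⊑ D p) (g : Poly (total D′)) → realised D′ g ≡ true →
  IsSignedMinor D (rename (block Θ) g) × (∀ ord → HasPositiveLeadingCoeff ord (rename (block Θ) g))
realised-sound {D′ = D′} {D = D} Θ g eq =
  let eq₁ , eq₂ = ∧-true (matches D′ g) eq
      eq₃ , eq₄ = ∧-true (does (dominated? g)) eq₂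
  in matches-sound Θ g eq₁ , λ ord → Dominated⇒positive ord
       (Dominated-rename (block {D = D} Θ) (does-true (dominated? g) eq₃))
       (rename-nonempty (block {D = D} Θ) g eq₄)

IsItem-realised : ∀ {g} → IsItem D g → IsSignedMinor D g × (∀ ord → HasPositiveLeadingCoeff ord g)
IsItem-realised {D = D} (κ , b , i , θ , refl) =
  let Θ , θ′ , eq = compress κ b i θ
  in subst (λ g → IsSignedMinor D g × (∀ ord → HasPositiveLeadingCoeff ord g)) (sym eq)
       (realised-sound Θ (item κ (minSize κ) i θ′) (item-realised κ i θ′))

listed-realised : ∀ {g} → (∀ p → 1 ≤ D p) → IsListed D g →
  IsSignedMinor D g × (∀ ord → HasPositiveLeadingCoeff ord g)
listed-realised {D = D} 1≤D listed = IsItem-realised {D = D} (listed-item 1≤D listed)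

-- From the classification to sign-normalised minors

IsClassified-respˡ : {f g : Poly (total D)} → f ≈ g → IsClassified D g → IsClassified D f
IsClassified-respˡ f≈g (inj₁ g≈0)               = inj₁ λ μ → trans (f≈g μ) (g≈0 μ)
IsClassified-respˡ {f = f} {g} f≈g (inj₂ (h , listed , g≈±h)) =
  inj₂ (h , listed , ≈±-respˡ {f = f} {g} f≈g g≈±h)

IsClassified-⊟ : (f : Poly (total D)) → IsClassified D (⊟ f) → IsClassified D f
IsClassified-⊟ f (inj₁ ⊟f≈0)               = inj₁ (⊟-≈-swap f [] ⊟f≈0)
IsClassified-⊟ f (inj₂ (g , listed , ⊟f≈±g)) = inj₂ (g , listed , ≈±-⊟ˡ ⊟f≈±g)

IsMinor-classified : (∀ p → 1 ≤ D p) → (f : Poly (total D)) → IsMinor 3 (laplacian D) f → IsClassified D f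
IsMinor-classified {D = D} 1≤D f (rows , cols , rows-inc , cols-inc , f≈) =
  let θ , θ≗ = fromIncreasing rows rows-inc
      η , η≗ = fromIncreasing cols cols-inc
      f≈minor : f ≈ minor (laplacian D) θ η
      f≈minor μ = trans (f≈ μ) (cong (λ g → coeff g μ)
        (det-cong λ a b → cong₂ (laplacian D) (sym (θ≗ a)) (sym (η≗ b))))
  in IsClassified-respˡ {D = D} {f} {minor (laplacian D) θ η} f≈minor (minor-classified D 1≤D θ η)

signedMinor⇒IsMinor : (f g : Poly (total D)) → IsSignedMinor D g → f ≈ g →
                      IsMinor 3 (laplacian D) f ⊎ IsMinor 3 (laplacian D) (⊟ f)
signedMinor⇒IsMinor f g (θ , η , plus eq) f≈g =
  inj₁ (⟦ θ ⟧ , ⟦ η ⟧ , ⟦⟧-increasing θ , ⟦⟧-increasing η , λ μ → trans (f≈g μ) (sym (eq μ)))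
signedMinor⇒IsMinor f g (θ , η , minus eq) f≈g =
  inj₂ (⟦ θ ⟧ , ⟦ η ⟧ , ⟦⟧-increasing θ , ⟦⟧-increasing η ,
    λ μ → trans (coeff-⊟ f μ) (trans (cong ℤ.-_ (f≈g μ)) (trans (sym (coeff-⊟ g μ)) (sym (eq μ)))))

theorem4p7 : ∀ (m n o : ℕ) → 1 ≤ m → 1 ≤ n → 1 ≤ o →
    (ord : MonomialOrder (size m n o)) (f : Poly (size m n o)) →
    IsSignNormalizedMinor ord 3 (L m n o) f ⇔ (∃[ g ] Listed m n o g × f ≈ g)
theorem4p7 m n o 1≤m 1≤n 1≤o ord f = mk⇔ to from
  where
  parts : Vector ℕ 3
  parts = ⟨ m , n , o ⟩

  1≤parts : ∀ p → 1 ≤ parts p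
  1≤parts = ⟨ 1≤m , 1≤n , 1≤o ⟩

  positive : ∀ {g} → Listed m n o g → HasPositiveLeadingCoeff ord g
  positive listed = proj₂ (listed-realised {D = parts} 1≤parts listed) ord

  -- Positivity settles the sign: zero has no leading coefficient, and `f ≈ ⊟ g` would make the
  -- leading coefficients of both `g` and `⊟ g` positive.
  select : HasPositiveLeadingCoeff ord f → IsClassified parts f → ∃[ g ] Listed m n o g × f ≈ g
  select pos (inj₁ f≈0) = contradiction (positive-resp-≈ ord {f} {[]} f≈0 pos) (zero-not-positive ord)
  select pos (inj₂ (g , listed , plus f≈g)) = g , listed , f≈g
  select pos (inj₂ (g , listed , minus f≈⊟g)) =
    contradiction (positive-resp-≈ ord {f} {⊟ g} f≈⊟g pos) (positive-asymmetric ord {g} (positive listed))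

  to : IsSignNormalizedMinor ord 3 (L m n o) f → ∃[ g ] Listed m n o g × f ≈ g
  to (inj₁ minor , pos) = select pos (IsMinor-classified {D = parts} 1≤parts f minor)
  to (inj₂ minor , pos) = select pos (IsClassified-⊟ {D = parts} f (IsMinor-classified {D = parts} 1≤parts (⊟ f) minor))

  from : ∃[ g ] Listed m n o g × f ≈ g → IsSignNormalizedMinor ord 3 (L m n o) f
  from (g , listed , f≈g) =
    signedMinor⇒IsMinor {D = parts} f g (proj₁ (listed-realised {D = parts} 1≤parts listed)) f≈g ,
    positive-resp-≈ ord {g} {f} (λ μ → sym (f≈g μ)) (positive listed)
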